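{- Let $\pi(p),\sigma(p)$ be unary DLE-terms positive in $p$ and $\lambda(p),\rho(p)$ unary DLE-terms negative in $p$. If $\phi\le\psi$ is a meta-inductive DLE-inequality (with respect to $\pi,\sigma,\lambda,\rho$), then there exists a safe and successful execution of the algorithm ALBA$^e$ on $\phi\le\psi$.
   Context: **Language DLE.** Fix disjoint sets $\mathcal F,\mathcal G$ of connectives; each $f\in\mathcal F$ (resp. $g\in\mathcal G$) has an arity $n_f$ (resp. $n_g$) and an order-type $\varepsilon_f\in\{1,\partial\}^{n_f}$ (resp. $\varepsilon_g\in\{1,\partial\}^{n_g}$). DLE-terms are built from propositional variables and $\bot,\top$ by $\wedge,\vee$ and the connectives in $\mathcal F\cup\mathcal G$. A term is positive (negative) in $p$ if every occurrence of $p$ lies under an even (odd) number of argument places of order-type $\partial$ ($\wedge,\vee$ have order-type $1$ in both arguments). **Language DLE$^*$.** The language of the same kind over $\mathcal F^*=\mathcal F\cup\{\dot\Diamond,\dot\lhd\}$, $\mathcal G^*=\mathcal G\cup\{\dot\Box,\dot\rhd\}$, the new connectives being unary, $\dot\Diamond,\dot\Box$ of order-type $1$ and $\dot\lhd,\dot\rhd$ of order-type $\partial$. **Inductive DLE$^*$-inequalities.** The positive (negative) signed generation tree $+s$ ($-s$) of a term $s$ is its generation tree with root signed $+$ ($-$), where children of nodes $\wedge,\vee$ get the parent's sign and the $i$-th child of a node labelled by a connective gets the parent's sign if the order-type at $i$ is $1$ and the opposite sign if it is $\partial$. Signed nodes are classified as follows ($f\in\mathcal F^*$, $g\in\mathcal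 G^*$). Skeleton nodes: $\Delta$-adjoints $+\vee,+\wedge,-\wedge,-\vee$; SLR nodes $+\wedge$, $+f$ with $n_f\ge1$, $-\vee$, $-g$ with $n_g\ge 1$. PIA nodes: SRA nodes $+\wedge$, $+g$ with $n_g=1$, $-\vee$, $-f$ with $n_f=1$; SRR nodes $+\vee$, $+g$ with $n_g\ge2$, $-\wedge$, $-f$ with $n_f\ge2$. A branch is good if it is the concatenation of two paths $P_1,P_2$ (one possibly of length $0$), where $P_1$ starts from the leaf and consists, apart from variable nodes, only of PIA nodes, and $P_2$ consists, apart from variable nodes, only of Skeleton nodes. For an order-type $\varepsilon\in\{1,\partial\}^n$ on $p_1,\dots,p_n$, a leaf $+p_i$ with $\varepsilon_i=1$ or $-p_i$ with $\varepsilon_i=\partial$ is $\varepsilon$-critical; a branch from such a leaf is an $\varepsilon$-critical branch. $\varepsilon^\partial$ is the opposite order-type. For a subterm $\gamma$ of $*s$ ($*\in\{+,-\}$), $\varepsilon^\partial(\gamma)\prec *s$ means that, with the signs inherited from $*s$, all variable leaves of $\gamma$ are $\varepsilon^\partial$-critical. Given $\varepsilon$ and an irreflexive transitive relation $<_\Omega$ on $p_1,\dots,p_n$, the tree $*s$ is $(\Omega,\varepsilon)$-inductive if for each $i$ every $\varepsilon$-critical branch with leaf $p_i$ is good, and every $m$-ary SRR node occurring in that branch is of the form $\circledast(\gamma_1,\dots,\gamma_{j-1},\beta,\gamma_{j+1},\dots,\gamma_m)$ (with $\beta$ the argument the branch passes through) where for every $h\ne j$: $\varepsilon^\partial(\gamma_h)\prec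 *s$, and $p_k<_\Omega p_i$ for every $p_k$ occurring in $\gamma_h$. An inequality $s\le t$ is inductive if for some $\Omega,\varepsilon$ both $+s$ and $-t$ are $(\Omega,\varepsilon)$-inductive. **Meta-inductive inequalities.** Let $\Phi(\dot\Diamond)=\pi$, $\Phi(\dot\Box)=\sigma$, $\Phi(\dot\lhd)=\lambda$, $\Phi(\dot\rhd)=\rho$. A DLE-inequality is meta-inductive if it is obtained from some inductive DLE$^*$-inequality by (recursively) replacing each subterm $\odot\theta$, $\odot\in\{\dot\Diamond,\dot\Box,\dot\lhd,\dot\rhd\}$, by $\Phi(\odot)(\theta)$. **Language DLE$^{++}$.** It expands DLE with two further sorts of variables, nominals $\mathbf i,\mathbf j,\dots$ and co-nominals $\mathbf m,\mathbf n,\dots$; with residuals $\to$ of $\wedge$ and $-$ of $\vee$; with residuals $\overline f^{(h)}$ of each $f\in\mathcal F$ ($1\le h\le n_f$) and $\underline g^{(k)}$ of each $g\in\mathcal G$ ($1\le k\le n_g$); and with unary connectives $\Diamond_\pi,\Box_\sigma,\lhd_\lambda,\rhd_\rho$ and their adjoints $\blacksquare_\pi,\mathsf{L}_\sigma,\blacktriangleleft_\lambda,\blacktriangleright_\rho$. ($\Diamond_\pi,\Box_\sigma,\blacksquare_\pi,\mathsf{L}_\sigma$ are monotone, $\lhd_\lambda,\rhd_\rho,\blacktriangleleft_\lambda,\blacktriangleright_\rho$ antitone; $\overline f^{(h)}$ and $\underline g^{(k)}$ have the polarities of the residuals determined by the residuation rules below; this determines positive and negative occurrences in DLE$^{++}$-terms.)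 A term is pure if it contains no propositional variables. **The algorithm ALBA$^e$** on input $\phi\le\psi$: (1) *Preprocessing.* In the signed trees $+\phi$ and $-\psi$, exhaustively: (a) push down, towards variables, occurrences of $+f$ (in coordinates with $\varepsilon_f(i)=1$), $+\wedge$, $-g$ (in coordinates with $\varepsilon_g(i)=\partial$) by distributing them over nodes $+\vee$ not below PIA nodes; and $-g$ (in coordinates with $\varepsilon_g(i)=1$), $-\vee$, $+f$ (in coordinates with $\varepsilon_f(i)=\partial$) by distributing them over nodes $-\wedge$ not below PIA nodes; moreover, in the same way, rewrite $\pi(\alpha\vee\beta)$ as $\pi(\alpha)\vee\pi(\beta)$ and $\lambda(\alpha\wedge\beta)$ as $\lambda(\alpha)\vee\lambda(\beta)$ (on left-hand sides of inequalities), and $\sigma(\alpha\wedge\beta)$ as $\sigma(\alpha)\wedge\sigma(\beta)$ and $\rho(\alpha\vee\beta)$ as $\rho(\alpha)\wedge\rho(\beta)$ (on right-hand sides). (b) Splitting: replace $\alpha\le\beta\wedge\gamma$ by $\alpha\le\beta$, $\alpha\le\gamma$, and $\alpha\vee\beta\le\gamma$ by $\alpha\le\gamma$, $\beta\le\gamma$. (c) Monotone/antitone variable elimination: for $\beta(p)$ positive and $\alpha(p)$ negative in $p$, replace $\alpha(p)\le\beta(p)$ by $\alpha(\bot)\le\beta(\bot)$, and $\beta(p)\le\alpha(p)$ by $\beta(\top)\le\alpha(\top)$. This yields finitely many inequalities $\phi_i\le\psi_i$; to each one applies *first approximation* once, obtaining the initial system $\{\mathbf i_0\le\phi_i,\ \psi_i\le\mathbf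 m_0\}$. A system $S$ stands for the quasi-inequality $\bigwedge S\Rightarrow\mathbf i_0\le\mathbf m_0$. (2) *Reduction–elimination.* Systems are transformed by the following rules, each replacing an inequality of the system (in the Ackermann rules: a set of inequalities) as indicated. Splitting as in (b). Residuation: $\alpha\wedge\beta\le\gamma$ becomes $\alpha\le\beta\to\gamma$ and $\alpha\le\beta\vee\gamma$ becomes $\alpha-\beta\le\gamma$ (up to commutativity); $f(\psi_1,\dots,\psi_h,\dots,\psi_{n_f})\le\chi$ becomes $\psi_h\le\overline f^{(h)}(\psi_1,\dots,\chi,\dots,\psi_{n_f})$ if $\varepsilon_f(h)=1$ and $\overline f^{(h)}(\psi_1,\dots,\chi,\dots,\psi_{n_f})\le\psi_h$ if $\varepsilon_f(h)=\partial$; $\chi\le g(\psi_1,\dots,\psi_k,\dots,\psi_{n_g})$ becomes $\underline g^{(k)}(\psi_1,\dots,\chi,\dots,\psi_{n_g})\le\psi_k$ if $\varepsilon_g(k)=1$ and $\psi_k\le\underline g^{(k)}(\psi_1,\dots,\chi,\dots,\psi_{n_g})$ if $\varepsilon_g(k)=\partial$. Approximation for $f,g$: $\mathbf i\le f(\psi_1,\dots,\psi_n)$ becomes $\mathbf i\le f(\mathbf j_1,\dots,\mathbf j_n)$ together with, for each $k$, $\mathbf j_k\le\psi_k$ with $\mathbf j_k$ a fresh nominal if $\varepsilon_f(k)=1$, or $\psi_k\le\mathbf j_k$ with $\mathbf j_k$ a fresh co-nominal if $\varepsilon_f(k)=\partial$; $g(\psi_1,\dots,\psi_n)\le\mathbf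 m$ becomes $g(\mathbf n_1,\dots,\mathbf n_n)\le\mathbf m$ together with, for each $k$, $\psi_k\le\mathbf n_k$ with $\mathbf n_k$ a fresh co-nominal if $\varepsilon_g(k)=1$, or $\mathbf n_k\le\psi_k$ with $\mathbf n_k$ a fresh nominal if $\varepsilon_g(k)=\partial$. Adjunction for the new connectives: $\pi(\alpha)\le\beta$ becomes $\pi(\bot)\le\beta$ and $\alpha\le\blacksquare_\pi\beta$; $\alpha\le\sigma(\beta)$ becomes $\alpha\le\sigma(\top)$ and $\mathsf{L}_\sigma\alpha\le\beta$; $\lambda(\alpha)\le\beta$ becomes $\lambda(\top)\le\beta$ and $\blacktriangleleft_\lambda\beta\le\alpha$; $\alpha\le\rho(\beta)$ becomes $\alpha\le\rho(\bot)$ and $\beta\le\blacktriangleright_\rho\alpha$. The first of the two resulting inequalities is called the side condition. Approximation for the new connectives: each replaces the system by two systems. $\mathbf i\le\pi(\alpha)$ is replaced in one by $\mathbf i\le\pi(\bot)$ and in the other by $\mathbf j\le\alpha$, $\mathbf i\le\Diamond_\pi(\mathbf j)$; $\sigma(\alpha)\le\mathbf m$ by $\sigma(\top)\le\mathbf m$, resp. $\alpha\le\mathbf n$, $\Box_\sigma(\mathbf n)\le\mathbf m$; $\mathbf i\le\lambda(\alpha)$ by $\mathbf i\le\lambda(\top)$, resp. $\alpha\le\mathbf m$, $\mathbf i\le\lhd_\lambda(\mathbf m)$; $\rho(\alpha)\le\mathbf m$ by $\rho(\bot)\le\mathbf m$, resp. $\mathbf i\le\alpha$, $\rhd_\rho(\mathbf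 i)\le\mathbf m$; with the newly introduced nominal/co-nominal fresh. Ackermann rules: if the inequalities of the system in which $p$ occurs are exactly $\alpha_i\le p$ ($1\le i\le n$) and $\beta_j(p)\le\gamma_j(p)$ ($1\le j\le m$), with $p$ not in any $\alpha_i$, all $\beta_j$ positive and all $\gamma_j$ negative in $p$, replace them all by $\beta_j(\bigvee_i\alpha_i)\le\gamma_j(\bigvee_i\alpha_i)$ ($1\le j\le m$). Dually, if they are $p\le\alpha_i$ and $\beta_j(p)\le\gamma_j(p)$ with $p$ not in any $\alpha_i$, all $\beta_j$ negative and all $\gamma_j$ positive in $p$, replace them by $\beta_j(\bigwedge_i\alpha_i)\le\gamma_j(\bigwedge_i\alpha_i)$. (Here $n=0$ is allowed, with empty join $\bot$ and empty meet $\top$.) (3) An execution is *successful* if all systems have been reduced to systems containing no propositional variables. An execution is *safe* if no side condition introduced by an application of an adjunction rule for the new connectives ($\pi,\sigma,\lambda,\rho$) is further modified, except for receiving substitutions by Ackermann rules. -}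

module Defs where

open import Level using (0ℓ)
open import Data.Fin using (Fin)
open import Data.List as List using (List; []; _∷_; _++_)
open import Data.List.Relation.Binary.Permutation.Propositional using (_↭_)
open import Data.List.Relation.Unary.All using (All; []; _∷_)
open import Data.Nat as ℕ using (ℕ)
open import Data.Product using (Σ; ∃; ∃₂; _×_; _,_; proj₁; proj₂)
open import Data.Sign using (Sign; +; -; opposite; _*_)
open import Data.Sum using (_⊎_; inj₁; inj₂; [_,_])
open import Data.Unit using (⊤)
open import Data.Vec as Vec using (Vec; []; _∷_; lookup; _[_]≔_)
open import Data.Vec.Functional using (updateAt)
open import Function using (_∘_; const)
open import Function.Definitions using (Injective)
open import Relation.Binary.Core using (Rel)
open import Relation.Binary.Construct.Closure.ReflexiveTransitive using (Star)
open import Relation.Binary.Definitions using (Irreflexive; Transitive)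
open import Relation.Binary.PropositionalEquality using (_≡_; _≢_)
open import Relation.Nullary using (¬_)

-- The order-types 1 and ∂ are the signs + and -, so that the sign of a child
-- is the product of the sign of its parent with the order-type.
OrderType : Set
OrderType = Sign

pattern 𝟏 = Sign.+
pattern ∂ = Sign.-

record Connectives : Set₁ where
  field
    Con : Set
    ar  : Con → ℕ
    ot  : (c : Con) → Fin (ar c) → OrderType

open Connectives public

infixr 5 _⊕_

_⊕_ : Connectives → Connectives → Connectives
(C ⊕ D) .Con = Con C ⊎ Con D
(C ⊕ D) .ar  = [ ar C , ar D ]
(C ⊕ D) .ot (inj₁ c) = ot C c
(C ⊕ D) .ot (inj₂ d) = ot D d

data Label (C : Connectives) : Set where
  meet join : Label C
  con       : Con C → Label C

arity : {C : Connectives} → Label C → ℕ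
arity meet        = 2
arity join        = 2
arity {C} (con c) = ar C c

order : {C : Connectives} (l : Label C) → Fin (arity l) → OrderType
order meet        _ = 𝟏
order join        _ = 𝟏
order {C} (con c) i = ot C c i

data Term (C : Connectives) (A : Set) : Set where
  atom    : A → Term C A
  bot top : Term C A
  node    : (l : Label C) → Vec (Term C A) (arity l) → Term C A

infixr 7 _∧_
infixr 6 _∨_

pattern _∧_ α β = node meet (α ∷ β ∷ [])
pattern _∨_ α β = node join (α ∷ β ∷ [])

infix 5 _≤_

record Inequality (C : Connectives) (A : Set) : Set where
  constructor _≤_
  field
    lhs rhs : Term C A

open Inequality public

module _ {C D : Connectives} {A B : Set}
         (k : (c : Con C) → Vec (Term D B) (ar C c) → Term D B)
         (ν : A → Term D B) where

  translate  : Term C A → Term D B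
  translates : {m : ℕ} → Vec (Term C A) m → Vec (Term D B) m

  translate (atom a)          = ν a
  translate bot               = bot
  translate top               = top
  translate (node meet ts)    = node meet (translates ts)
  translate (node join ts)    = node join (translates ts)
  translate (node (con c) ts) = k c (translates ts)

  translates []       = []
  translates (t ∷ ts) = translate t ∷ translates ts

subst : {C : Connectives} {A B : Set} → (A → Term C B) → Term C A → Term C B
subst = translate (λ c → node (con c))

-- Branch τ s τ′ a: a branch of the generation tree of s with root signed τ,
-- ending in a leaf a signed τ′.
data Branch {C : Connectives} {A : Set} : Sign → Term C A → Sign → A → Set where
  leaf    : {τ : Sign} {a : A} → Branch τ (atom a) τ a
  through : {τ τ′ : Sign} {a : A} {l : Label C} {ts : Vec (Term C A) (arity l)}
            (j : Fin (arity l)) → Branch (τ * order l j) (lookup ts j) τ′ a →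
            Branch τ (node l ts) τ′ a

Occurs : {C : Connectives} {A : Set} → A → Term C A → Set
Occurs a s = ∃ λ τ → Branch + s τ a

-- A leaf of +s is signed + iff it lies under an even number of argument places
-- of order-type ∂.
Positive Negative : {C : Connectives} {A : Set} → A → Term C A → Set
Positive a s = ∀ {τ} → Branch + s τ a → τ ≡ +
Negative a s = ∀ {τ} → Branch + s τ a → τ ≡ -

record Signature : Set₁ where
  field
    F G : Connectives

open Signature public

language : Signature → Connectives
language S = F S ⊕ G S

DLE : Signature → ℕ → Set
DLE S n = Term (language S) (Fin n)

pattern 𝒻 f = con (inj₁ f)
pattern ℊ g = con (inj₂ g)

module GenerationTree (S : Signature) where

  SignedNode : Set
  SignedNode = Sign × Label (language S)

  data ΔAdjoint : SignedNode → Set where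
    +∨ : ΔAdjoint (+ , join)
    +∧ : ΔAdjoint (+ , meet)
    -∧ : ΔAdjoint (- , meet)
    -∨ : ΔAdjoint (- , join)

  data SLR : SignedNode → Set where
    +∧ : SLR (+ , meet)
    +f : {f : Con (F S)} → 1 ℕ.≤ ar (F S) f → SLR (+ , 𝒻 f)
    -∨ : SLR (- , join)
    -g : {g : Con (G S)} → 1 ℕ.≤ ar (G S) g → SLR (- , ℊ g)

  data SRA : SignedNode → Set where
    +∧ : SRA (+ , meet)
    +g : {g : Con (G S)} → ar (G S) g ≡ 1 → SRA (+ , ℊ g)
    -∨ : SRA (- , join)
    -f : {f : Con (F S)} → ar (F S) f ≡ 1 → SRA (- , 𝒻 f)

  data SRR : SignedNode → Set where
    +∨ : SRR (+ , join)
    +g : {g : Con (G S)} → 2 ℕ.≤ ar (G S) g → SRR (+ , ℊ g)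
    -∧ : SRR (- , meet)
    -f : {f : Con (F S)} → 2 ℕ.≤ ar (F S) f → SRR (- , 𝒻 f)

  Skeleton PIA : SignedNode → Set
  Skeleton x = ΔAdjoint x ⊎ SLR x
  PIA x      = SRA x ⊎ SRR x

  -- From the root to the leaf, leaving out the variable node.
  nodes : {n : ℕ} {τ τ′ : Sign} {s : DLE S n} {i : Fin n} →
          Branch τ s τ′ i → List SignedNode
  nodes leaf                    = []
  nodes (through {τ} {l = l} j b) = (τ , l) ∷ nodes b

  Good : {n : ℕ} {τ τ′ : Sign} {s : DLE S n} {i : Fin n} → Branch τ s τ′ i → Set
  Good b = ∃₂ λ P₂ P₁ → nodes b ≡ P₂ ++ P₁ × All Skeleton P₂ × All PIA P₁

  -- At each SRR node of the branch, every leaf p_k of a side argument γ_h is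
  -- ε^∂-critical and satisfies p_k <_Ω p_i.
  SRRCondition : {n : ℕ} → Rel (Fin n) 0ℓ → (Fin n → OrderType) →
                 {τ τ′ : Sign} {s : DLE S n} {i : Fin n} → Branch τ s τ′ i → Set
  SRRCondition _<_ ε leaf = ⊤
  SRRCondition _<_ ε (through {τ} {a = i} {l} {ts} j b) =
    (SRR (τ , l) → ∀ h → h ≢ j → ∀ {τ′ k} →
       Branch (τ * order l h) (lookup ts h) τ′ k →
       τ′ ≡ opposite (ε k) × k < i)
    × SRRCondition _<_ ε b

  -- A leaf p_i signed τ is ε-critical iff τ ≡ ε i.
  InductiveTree : {n : ℕ} → Rel (Fin n) 0ℓ → (Fin n → OrderType) →
                  Sign → DLE S n → Set
  InductiveTree _<_ ε τ s =
    ∀ {i} (b : Branch τ s (ε i) i) → Good b × SRRCondition _<_ ε b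

  Inductive : {n : ℕ} → DLE S n → DLE S n → Set₁
  Inductive {n} s t =
    Σ (Fin n → OrderType) λ ε → Σ (Rel (Fin n) 0ℓ) λ _<_ →
      Irreflexive _≡_ _<_ × Transitive _<_ ×
      InductiveTree _<_ ε + s × InductiveTree _<_ ε - t

  Δ : {n : ℕ} → Sign → DLE S n → DLE S n → DLE S n
  Δ + α β = α ∨ β
  Δ - α β = α ∧ β

  -- All distribution laws at once: a node +∧, +f (resp. -∨, -g) with a child
  -- +∨ or -∧ becomes a node +∨ (resp. -∧); whether the child is +∨ or -∧
  -- depends on its sign, hence on the order-type of its coordinate. A redex is
  -- not below PIA nodes when all nodes above it are Skeleton nodes; the nodes
  -- +∧, +∨, -∧, -∨, which belong to both classes, thus do not block it.
  data Distribute {n : ℕ} : Sign → DLE S n → DLE S n → Set where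
    push   : {τ : Sign} {l : Label (language S)} {ts : Vec (DLE S n) (arity l)}
             {α β : DLE S n} (j : Fin (arity l)) → SLR (τ , l) →
             lookup ts j ≡ Δ (τ * order l j) α β →
             Distribute τ (node l ts)
               (Δ τ (node l (ts [ j ]≔ α)) (node l (ts [ j ]≔ β)))
    within : {τ : Sign} {l : Label (language S)} {ts : Vec (DLE S n) (arity l)}
             {u : DLE S n} (j : Fin (arity l)) → Skeleton (τ , l) →
             Distribute (τ * order l j) (lookup ts j) u →
             Distribute τ (node l ts) (node l (ts [ j ]≔ u))

data NewF : Set where
  ◇• ◁• : NewF

data NewG : Set where
  □• ▷• : NewG

newF newG : Connectives
newF .Con     = NewF
newF .ar _    = 1
newF .ot ◇• _ = 𝟏
newF .ot ◁• _ = ∂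
newG .Con     = NewG
newG .ar _    = 1
newG .ot □• _ = 𝟏
newG .ot ▷• _ = ∂

infix 10 _*ˢ

_*ˢ : Signature → Signature
(S *ˢ) .F = F S ⊕ newF
(S *ˢ) .G = G S ⊕ newG

DLE* : Signature → ℕ → Set
DLE* S = DLE (S *ˢ)

-- Residual in coordinate h of an operation of order-type ε. For instance, if
-- ε h = 1 then ψ_h ≤ f̄⁽ʰ⁾(…,χ,…) iff f(…,ψ_h,…) ≤ χ, so f̄⁽ʰ⁾ is monotone in χ
-- and has the opposite polarities in the other coordinates; if ε h = ∂ then
-- f̄⁽ʰ⁾(…,χ,…) ≤ ψ_h iff f(…,ψ_h,…) ≤ χ, so f̄⁽ʰ⁾ is antitone in χ and has the
-- same polarities in the other coordinates.
residual : {m : ℕ} → (Fin m → OrderType) → Fin m → Fin m → OrderType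
residual ε h = updateAt (λ i → opposite (ε h * ε i)) h (const (ε h))

data Con⁺⁺ (S : Signature) : Set where
  dle         : Con (language S) → Con⁺⁺ S
  imp minus   : Con⁺⁺ S
  resF        : (f : Con (F S)) → Fin (ar (F S) f) → Con⁺⁺ S
  resG        : (g : Con (G S)) → Fin (ar (G S) g) → Con⁺⁺ S
  ◇π □σ ◁λ ▷ρ : Con⁺⁺ S
  ■π Lσ ◂λ ▸ρ : Con⁺⁺ S

language⁺⁺ : Signature → Connectives
language⁺⁺ S .Con = Con⁺⁺ S
language⁺⁺ S .ar (dle c)    = ar (language S) c
language⁺⁺ S .ar imp        = 2
language⁺⁺ S .ar minus      = 2
language⁺⁺ S .ar (resF f _) = ar (F S) f
language⁺⁺ S .ar (resG g _) = ar (G S) g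
language⁺⁺ S .ar ◇π = 1
language⁺⁺ S .ar □σ = 1
language⁺⁺ S .ar ◁λ = 1
language⁺⁺ S .ar ▷ρ = 1
language⁺⁺ S .ar ■π = 1
language⁺⁺ S .ar Lσ = 1
language⁺⁺ S .ar ◂λ = 1
language⁺⁺ S .ar ▸ρ = 1
language⁺⁺ S .ot (dle c)    = ot (language S) c
language⁺⁺ S .ot imp        = lookup (∂ ∷ 𝟏 ∷ [])
language⁺⁺ S .ot minus      = lookup (𝟏 ∷ ∂ ∷ [])
language⁺⁺ S .ot (resF f h) = residual (ot (F S) f) h
language⁺⁺ S .ot (resG g k) = residual (ot (G S) g) k
language⁺⁺ S .ot ◇π _ = 𝟏
language⁺⁺ S .ot □σ _ = 𝟏
language⁺⁺ S .ot ◁λ _ = ∂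
language⁺⁺ S .ot ▷ρ _ = ∂
language⁺⁺ S .ot ■π _ = 𝟏
language⁺⁺ S .ot Lσ _ = 𝟏
language⁺⁺ S .ot ◂λ _ = ∂
language⁺⁺ S .ot ▸ρ _ = ∂

data Atom (n : ℕ) : Set where
  prop : Fin n → Atom n
  nom  : ℕ → Atom n
  cnom : ℕ → Atom n

DLE⁺⁺ : Signature → ℕ → Set
DLE⁺⁺ S n = Term (language⁺⁺ S) (Atom n)

module ALBAᵉ (S : Signature) (π σ λᵗ ρ : DLE S 1) where

  open GenerationTree (S *ˢ)

  _⟨_⟩ : {n : ℕ} → DLE S 1 → DLE S n → DLE S n
  θ ⟨ α ⟩ = subst (const α) θ

  Φ : {n : ℕ} → DLE* S n → DLE S n
  Φ {n} = translate k atom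
    where
    k : (c : Con (language (S *ˢ))) →
        Vec (DLE S n) (ar (language (S *ˢ)) c) → DLE S n
    k (inj₁ (inj₁ f))  ts       = node (𝒻 f) ts
    k (inj₁ (inj₂ ◇•)) (θ ∷ []) = π ⟨ θ ⟩
    k (inj₁ (inj₂ ◁•)) (θ ∷ []) = λᵗ ⟨ θ ⟩
    k (inj₂ (inj₁ g))  ts       = node (ℊ g) ts
    k (inj₂ (inj₂ □•)) (θ ∷ []) = σ ⟨ θ ⟩
    k (inj₂ (inj₂ ▷•)) (θ ∷ []) = ρ ⟨ θ ⟩

  MetaInductive : {n : ℕ} → DLE S n → DLE S n → Set₁
  MetaInductive {n} φ ψ =
    Σ (DLE* S n) λ s → Σ (DLE* S n) λ t →
      Inductive s t × Φ s ≡ φ × Φ t ≡ ψ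

  -- Preprocessing acts on DLE*-terms, which record the subterms of the
  -- input that are treated as units π(α), σ(α), λ(α), ρ(α): Distribute on
  -- ◇•, □•, ◁•, ▷• is distribution of +π, -σ, +λ, -ρ, and the other laws do not
  -- break up π, σ, λ, ρ themselves. Polarity and occurrence of variables are
  -- those of the DLE-terms denoted.

  Inequality* : ℕ → Set
  Inequality* n = Inequality (language (S *ˢ)) (Fin n)

  _[_≔_]* : {n : ℕ} → DLE* S n → Fin n → DLE* S n → DLE* S n
  s [ p ≔ u ]* = subst (updateAt atom p (const u)) s

  infix 3 _⟶_ _⟶ᴸ_

  data _⟶_ {n : ℕ} : Inequality* n → List (Inequality* n) → Set where
    distribute-l : {s s′ t : DLE* S n} → Distribute + s s′ →
                   s ≤ t ⟶ (s′ ≤ t) ∷ []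
    distribute-r : {s t t′ : DLE* S n} → Distribute - t t′ →
                   s ≤ t ⟶ (s ≤ t′) ∷ []
    split-∧      : {α β γ : DLE* S n} →
                   α ≤ β ∧ γ ⟶ (α ≤ β) ∷ (α ≤ γ) ∷ []
    split-∨      : {α β γ : DLE* S n} →
                   α ∨ β ≤ γ ⟶ (α ≤ γ) ∷ (β ≤ γ) ∷ []
    eliminate-⊥  : {α β : DLE* S n} (p : Fin n) →
                   Occurs p (Φ α) ⊎ Occurs p (Φ β) →
                   Negative p (Φ α) → Positive p (Φ β) →
                   α ≤ β ⟶ (α [ p ≔ bot ]* ≤ β [ p ≔ bot ]*) ∷ []
    eliminate-⊤  : {α β : DLE* S n} (p : Fin n) →
                   Occurs p (Φ α) ⊎ Occurs p (Φ β) →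
                   Positive p (Φ β) → Negative p (Φ α) →
                   β ≤ α ⟶ (β [ p ≔ top ]* ≤ α [ p ≔ top ]*) ∷ []

  data _⟶ᴸ_ {n : ℕ} : List (Inequality* n) → List (Inequality* n) → Set where
    at : {e : Inequality* n} {es : List (Inequality* n)}
         (xs ys : List (Inequality* n)) → e ⟶ es →
         xs ++ e ∷ ys ⟶ᴸ xs ++ es ++ ys

  Exhausted : {n : ℕ} → Inequality* n → Set
  Exhausted e = ∀ {es} → ¬ (e ⟶ es)

  -- Systems are lists read up to permutation; the tag marks the side conditions.

  Inequality⁺⁺ : ℕ → Set
  Inequality⁺⁺ n = Inequality (language⁺⁺ S) (Atom n)

  data Status : Set where
    ordinary side : Status

  Item : ℕ → Set
  Item n = Status × Inequality⁺⁺ n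

  System : ℕ → Set
  System n = List (Item n)

  embed : {n : ℕ} → DLE S n → DLE⁺⁺ S n
  embed = translate (λ c → node (con (dle c))) (atom ∘ prop)

  _⟪_⟫ : {n : ℕ} → DLE S 1 → DLE⁺⁺ S n → DLE⁺⁺ S n
  θ ⟪ α ⟫ = translate (λ c → node (con (dle c))) (const α) θ

  𝐢₀ 𝐦₀ : {n : ℕ} → Atom n
  𝐢₀ = nom 0
  𝐦₀ = cnom 0

  firstApproximation : {n : ℕ} → Inequality* n → System n
  firstApproximation (s ≤ t) =
    (ordinary , atom 𝐢₀ ≤ embed (Φ s)) ∷ (ordinary , embed (Φ t) ≤ atom 𝐦₀) ∷ []

  -- 𝐢₀ and 𝐦₀ occur in the quasi-inequality even when they do not occur in its
  -- antecedent.
  Fresh : {n : ℕ} → Atom n → System n → Set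
  Fresh a Γ = a ≢ 𝐢₀ × a ≢ 𝐦₀ ×
    All (λ (_ , e) → ¬ Occurs a (lhs e) × ¬ Occurs a (rhs e)) Γ

  orient : {n : ℕ} → OrderType → DLE⁺⁺ S n → DLE⁺⁺ S n → Inequality⁺⁺ n
  orient 𝟏 α β = α ≤ β
  orient ∂ α β = β ≤ α

  name : {n : ℕ} → OrderType → ℕ → Atom n
  name 𝟏 = nom
  name ∂ = cnom

  -- Rule Γ e Δs: an inequality e of the system Γ may be replaced by the
  -- inequalities in Δ, giving one system for each Δ in Δs.
  data Rule {n : ℕ} (Γ : System n) : Inequality⁺⁺ n → List (List (Item n)) → Set where
    split-∧ : {α β γ : DLE⁺⁺ S n} →
      Rule Γ (α ≤ β ∧ γ) (((ordinary , α ≤ β) ∷ (ordinary , α ≤ γ) ∷ []) ∷ [])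
    split-∨ : {α β γ : DLE⁺⁺ S n} →
      Rule Γ (α ∨ β ≤ γ) (((ordinary , α ≤ γ) ∷ (ordinary , β ≤ γ) ∷ []) ∷ [])

    residuate-∧₁ : {α β γ : DLE⁺⁺ S n} →
      Rule Γ (α ∧ β ≤ γ) (((ordinary , α ≤ node (con imp) (β ∷ γ ∷ [])) ∷ []) ∷ [])
    residuate-∧₂ : {α β γ : DLE⁺⁺ S n} →
      Rule Γ (α ∧ β ≤ γ) (((ordinary , β ≤ node (con imp) (α ∷ γ ∷ [])) ∷ []) ∷ [])
    residuate-∨₁ : {α β γ : DLE⁺⁺ S n} →
      Rule Γ (α ≤ β ∨ γ) (((ordinary , node (con minus) (α ∷ β ∷ []) ≤ γ) ∷ []) ∷ [])
    residuate-∨₂ : {α β γ : DLE⁺⁺ S n} →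
      Rule Γ (α ≤ β ∨ γ) (((ordinary , node (con minus) (α ∷ γ ∷ []) ≤ β) ∷ []) ∷ [])
    residuate-f : {f : Con (F S)} {ψs : Vec (DLE⁺⁺ S n) (ar (F S) f)} {χ : DLE⁺⁺ S n}
      (h : Fin (ar (F S) f)) →
      Rule Γ (node (con (dle (inj₁ f))) ψs ≤ χ)
        (((ordinary , orient (ot (F S) f h) (lookup ψs h)
                             (node (con (resF f h)) (ψs [ h ]≔ χ))) ∷ []) ∷ [])
    residuate-g : {g : Con (G S)} {ψs : Vec (DLE⁺⁺ S n) (ar (G S) g)} {χ : DLE⁺⁺ S n}
      (k : Fin (ar (G S) g)) →
      Rule Γ (χ ≤ node (con (dle (inj₂ g))) ψs)
        (((ordinary , orient (ot (G S) g k) (node (con (resG g k)) (ψs [ k ]≔ χ))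
                             (lookup ψs k)) ∷ []) ∷ [])

    approximate-f : {f : Con (F S)} {ψs : Vec (DLE⁺⁺ S n) (ar (F S) f)} {i : ℕ}
      (x : Fin (ar (F S) f) → ℕ) →
      let 𝐣 : Fin (ar (F S) f) → Atom n
          𝐣 k = name (ot (F S) f k) (x k) in
      Injective _≡_ _≡_ 𝐣 → (∀ k → Fresh (𝐣 k) Γ) →
      Rule Γ (atom (nom i) ≤ node (con (dle (inj₁ f))) ψs)
        (((ordinary , atom (nom i) ≤ node (con (dle (inj₁ f))) (Vec.tabulate (atom ∘ 𝐣)))
          ∷ List.tabulate (λ k →
              ordinary , orient (ot (F S) f k) (atom (𝐣 k)) (lookup ψs k))) ∷ [])
    approximate-g : {g : Con (G S)} {ψs : Vec (DLE⁺⁺ S n) (ar (G S) g)} {m : ℕ}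
      (x : Fin (ar (G S) g) → ℕ) →
      let 𝐧 : Fin (ar (G S) g) → Atom n
          𝐧 k = name (opposite (ot (G S) g k)) (x k) in
      Injective _≡_ _≡_ 𝐧 → (∀ k → Fresh (𝐧 k) Γ) →
      Rule Γ (node (con (dle (inj₂ g))) ψs ≤ atom (cnom m))
        (((ordinary , node (con (dle (inj₂ g))) (Vec.tabulate (atom ∘ 𝐧)) ≤ atom (cnom m))
          ∷ List.tabulate (λ k →
              ordinary , orient (ot (G S) g k) (lookup ψs k) (atom (𝐧 k)))) ∷ [])

    adjunction-π : {α β : DLE⁺⁺ S n} →
      Rule Γ (π ⟪ α ⟫ ≤ β)
        (((side , π ⟪ bot ⟫ ≤ β) ∷ (ordinary , α ≤ node (con ■π) (β ∷ [])) ∷ []) ∷ [])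
    adjunction-σ : {α β : DLE⁺⁺ S n} →
      Rule Γ (α ≤ σ ⟪ β ⟫)
        (((side , α ≤ σ ⟪ top ⟫) ∷ (ordinary , node (con Lσ) (α ∷ []) ≤ β) ∷ []) ∷ [])
    adjunction-λ : {α β : DLE⁺⁺ S n} →
      Rule Γ (λᵗ ⟪ α ⟫ ≤ β)
        (((side , λᵗ ⟪ top ⟫ ≤ β) ∷ (ordinary , node (con ◂λ) (β ∷ []) ≤ α) ∷ []) ∷ [])
    adjunction-ρ : {α β : DLE⁺⁺ S n} →
      Rule Γ (α ≤ ρ ⟪ β ⟫)
        (((side , α ≤ ρ ⟪ bot ⟫) ∷ (ordinary , β ≤ node (con ▸ρ) (α ∷ [])) ∷ []) ∷ [])

    approximate-π : {α : DLE⁺⁺ S n} {i : ℕ} (j : ℕ) → Fresh (nom j) Γ →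
      Rule Γ (atom (nom i) ≤ π ⟪ α ⟫)
        (((ordinary , atom (nom i) ≤ π ⟪ bot ⟫) ∷ [])
         ∷ ((ordinary , atom (nom j) ≤ α)
            ∷ (ordinary , atom (nom i) ≤ node (con ◇π) (atom (nom j) ∷ [])) ∷ [])
         ∷ [])
    approximate-σ : {α : DLE⁺⁺ S n} {m : ℕ} (k : ℕ) → Fresh (cnom k) Γ →
      Rule Γ (σ ⟪ α ⟫ ≤ atom (cnom m))
        (((ordinary , σ ⟪ top ⟫ ≤ atom (cnom m)) ∷ [])
         ∷ ((ordinary , α ≤ atom (cnom k))
            ∷ (ordinary , node (con □σ) (atom (cnom k) ∷ []) ≤ atom (cnom m)) ∷ [])
         ∷ [])
    approximate-λ : {α : DLE⁺⁺ S n} {i : ℕ} (m : ℕ) → Fresh (cnom m) Γ →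
      Rule Γ (atom (nom i) ≤ λᵗ ⟪ α ⟫)
        (((ordinary , atom (nom i) ≤ λᵗ ⟪ top ⟫) ∷ [])
         ∷ ((ordinary , α ≤ atom (cnom m))
            ∷ (ordinary , atom (nom i) ≤ node (con ◁λ) (atom (cnom m) ∷ [])) ∷ [])
         ∷ [])
    approximate-ρ : {α : DLE⁺⁺ S n} {m : ℕ} (i : ℕ) → Fresh (nom i) Γ →
      Rule Γ (ρ ⟪ α ⟫ ≤ atom (cnom m))
        (((ordinary , ρ ⟪ bot ⟫ ≤ atom (cnom m)) ∷ [])
         ∷ ((ordinary , atom (nom i) ≤ α)
            ∷ (ordinary , node (con ▷ρ) (atom (nom i) ∷ []) ≤ atom (cnom m)) ∷ [])
         ∷ [])

  ⋁ ⋀ : {n : ℕ} → List (DLE⁺⁺ S n) → DLE⁺⁺ S n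
  ⋁ []           = bot
  ⋁ (α ∷ [])     = α
  ⋁ (α ∷ β ∷ γs) = α ∨ ⋁ (β ∷ γs)
  ⋀ []           = top
  ⋀ (α ∷ [])     = α
  ⋀ (α ∷ β ∷ γs) = α ∧ ⋀ (β ∷ γs)

  _[_≔_] : {n : ℕ} → DLE⁺⁺ S n → Fin n → DLE⁺⁺ S n → DLE⁺⁺ S n
  t [ p ≔ u ] = subst ν t
    where
    ν : Atom _ → DLE⁺⁺ S _
    ν (prop q) = updateAt (atom ∘ prop) p (const u) q
    ν (nom j)  = atom (nom j)
    ν (cnom m) = atom (cnom m)

  substItem : {n : ℕ} → Fin n → DLE⁺⁺ S n → Item n → Item n
  substItem p u (st , β ≤ γ) = st , β [ p ≔ u ] ≤ γ [ p ≔ u ]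

  -- In the Ackermann rules Θ also contains the inequalities without p, which
  -- meet the polarity requirement vacuously and are fixed by the substitution.
  infix 3 _⇒_

  data _⇒_ {n : ℕ} (Γ : System n) : List (System n) → Set where
    local : {st : Status} {e : Inequality⁺⁺ n} {Θ : System n} {Δs : List (List (Item n))} →
      Γ ↭ (st , e) ∷ Θ → Rule Γ e Δs → Γ ⇒ List.map (_++ Θ) Δs
    ackermann : (p : Fin n) (αs : List (Status × DLE⁺⁺ S n)) {Θ : System n} →
      Γ ↭ List.map (λ (st , α) → st , α ≤ atom (prop p)) αs ++ Θ →
      All (λ (_ , α) → ¬ Occurs (prop p) α) αs →
      All (λ (_ , e) → Positive (prop p) (lhs e) × Negative (prop p) (rhs e)) Θ →
      Γ ⇒ List.map (substItem p (⋁ (List.map proj₂ αs))) Θ ∷ []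
    ackermann-dual : (p : Fin n) (αs : List (Status × DLE⁺⁺ S n)) {Θ : System n} →
      Γ ↭ List.map (λ (st , α) → st , atom (prop p) ≤ α) αs ++ Θ →
      All (λ (_ , α) → ¬ Occurs (prop p) α) αs →
      All (λ (_ , e) → Negative (prop p) (lhs e) × Positive (prop p) (rhs e)) Θ →
      Γ ⇒ List.map (substItem p (⋀ (List.map proj₂ αs))) Θ ∷ []

  data Run {n : ℕ} (Γ : System n) : Set where
    stop : Run Γ
    step : {Γs : List (System n)} → Γ ⇒ Γs → All Run Γs → Run Γ

  Pure : {n : ℕ} → System n → Set
  Pure = All (λ (_ , e) → ∀ p → ¬ Occurs (prop p) (lhs e) × ¬ Occurs (prop p) (rhs e))

  SuccessfulRun  : {n : ℕ} {Γ : System n} → Run Γ → Set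
  SuccessfulRuns : {n : ℕ} {Γs : List (System n)} → All Run Γs → Set
  SuccessfulRun {Γ = Γ} stop = Pure Γ
  SuccessfulRun (step _ rs)  = SuccessfulRuns rs
  SuccessfulRuns []          = ⊤
  SuccessfulRuns (r ∷ rs)    = SuccessfulRun r × SuccessfulRuns rs

  -- A side condition may be among the inequalities that receive a substitution
  -- in an Ackermann rule, but not among the α ≤ p (resp. p ≤ α) used up by it.
  SafeStep : {n : ℕ} {Γ : System n} {Γs : List (System n)} → Γ ⇒ Γs → Set
  SafeStep (local {st} _ _)            = st ≡ ordinary
  SafeStep (ackermann _ αs _ _ _)      = All (λ (st , _) → st ≡ ordinary) αs
  SafeStep (ackermann-dual _ αs _ _ _) = All (λ (st , _) → st ≡ ordinary) αs

  SafeRun  : {n : ℕ} {Γ : System n} → Run Γ → Set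
  SafeRuns : {n : ℕ} {Γs : List (System n)} → All Run Γs → Set
  SafeRun stop        = ⊤
  SafeRun (step x rs) = SafeStep x × SafeRuns rs
  SafeRuns []         = ⊤
  SafeRuns (r ∷ rs)   = SafeRun r × SafeRuns rs

  record Execution {n : ℕ} (φ ψ : DLE S n) : Set where
    field
      {s t}        : DLE* S n
      {es}         : List (Inequality* n)
      reads-φ      : Φ s ≡ φ
      reads-ψ      : Φ t ≡ ψ
      preprocessed : Star _⟶ᴸ_ ((s ≤ t) ∷ []) es
      exhausted    : All Exhausted es
      runs         : All Run (List.map firstApproximation es)

  open Execution public

  Successful Safe : {n : ℕ} {φ ψ : DLE S n} → Execution φ ψ → Set
  Successful x = SuccessfulRuns (runs x)
  Safe x       = SafeRuns (runs x)

{-# OPTIONS --safe #-}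

-- Preprocessing terminates since distribution, splitting and elimination all
-- decrease a polynomial weight, and it keeps the critical branches good. In an
-- exhausted inequality no node +∨ or -∧ is reachable through skeleton nodes, so
-- the approximation rules take a system down to the PIA subtrees. There,
-- residuation and adjunction along a critical branch ending in p_i display p_i:
-- the side arguments that are moved across have non-critical leaves below p_i.
-- Everything but the displayed inequalities α ≤ p_i (resp. p_i ≤ α), side
-- conditions included, has only non-critical leaves, so that it just receives
-- the substitutions of the Ackermann rules.
module Submission where

open import Defs
open import Data.Fin as Fin using (Fin; zero; suc; toℕ)
import Data.Fin.Properties as Fin
open import Data.List as List using (List; []; _∷_; _++_)
open import Data.List.Membership.Propositional using (_∈_)
open import Data.List.Membership.Propositional.Properties using (∈-allFin)
open import Data.List.Properties using (++-assoc; ++-identityʳ; ∷-injectiveˡ; ∷-injectiveʳ)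
open import Data.List.Relation.Binary.Permutation.Propositional
  using (_↭_; ↭-refl; ↭-sym; ↭-trans; ↭-reflexive; ↭-prep)
open import Data.List.Relation.Binary.Permutation.Propositional.Properties
  using (shift; shifts; All-resp-↭)
open import Data.List.Relation.Unary.All as All using (All; []; _∷_)
import Data.List.Relation.Unary.All.Properties as All
open import Data.List.Relation.Unary.Any using (here; there)
open import Data.Nat as ℕ using (ℕ; s≤s; z≤n)
open import Data.Nat.Induction using (<-wellFounded)
import Data.Nat.Properties as ℕ
open import Data.Nat.Tactic.RingSolver using (solve-∀)
open import Data.Product using (Σ; ∃; ∃₂; _×_; _,_; proj₁; proj₂)
open import Data.Sign using (Sign; +; -; opposite; _*_)
import Data.Sign.Properties as Sign
open import Data.Sum using (_⊎_; inj₁; inj₂; [_,_])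
open import Data.Unit using (⊤; tt)
open import Data.Vec as Vec using (Vec; []; _∷_; lookup; _[_]≔_)
open import Data.Vec.Functional using (updateAt)
open import Data.Vec.Functional.Properties using (updateAt-minimal; updateAt-updates)
open import Data.Vec.Properties
  using (lookup∘tabulate; lookup∘update; lookup∘update′; []≔-lookup)
open import Function using (_∘_; const; case_of_)
open import Induction.WellFounded using (Acc; acc)
open import Level using (0ℓ)
open import Relation.Binary.Construct.Closure.ReflexiveTransitive as Star
  using (Star; _◅_; _◅◅_)
open import Relation.Binary.Core using (Rel)
open import Relation.Binary.Definitions using (DecidableEquality; Irreflexive; Transitive)
open import Relation.Binary.PropositionalEquality as ≡
  using (_≡_; _≢_; refl; sym; trans; cong; cong₂)
open import Relation.Nullary using (¬_; Dec; yes; no; contradiction)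
open import Relation.Nullary.Decidable using (map′; _×-dec_; _⊎-dec_)
open import Relation.Unary using (U)

-- Sign left-hand sides of inequalities by - and right-hand sides by +. Every reduction rule,
-- residuation included, then leaves the sign of each moved subterm unchanged, so criticality can be
-- read off single inequalities throughout a run. If all leaves besides the displayed `p_i` are
-- non-critical, the polarities that an Ackermann rule demands are there at once, and substituting
-- for such a leaf a term that is non-critical under that leaf's sign preserves the invariant. The
-- hypotheses on `π`, `σ`, `λᵗ`, `ρ` enter through `Φ-branch`: each leaf of `Φ s` comes from an
-- equally signed leaf of `s`. The converse fails, because a unit need not contain its variable;
-- hence all invariants bound the leaves from above. The inductive condition restrains side
-- arguments only along critical branches. Displaying therefore has to stop as soon as a subterm has
-- no critical leaf, and units inside such a subterm are left untouched.

opposite-* : ∀ σ τ → opposite (σ * τ) ≡ opposite σ * τ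
opposite-* + τ = refl
opposite-* - τ = Sign.opposite-involutive τ

≢⇒≡opposite : ∀ {σ τ} → σ ≢ τ → σ ≡ opposite τ
≢⇒≡opposite { - } { - } σ≢τ = contradiction refl σ≢τ
≢⇒≡opposite { - } {+}  σ≢τ = refl
≢⇒≡opposite {+}  { - } σ≢τ = refl
≢⇒≡opposite {+}  {+}  σ≢τ = contradiction refl σ≢τ

-- Branches of generation trees and their decidability

module _ {C : Connectives} {A : Set} where

  Term-induction : (P : Term C A → Set) → (∀ a → P (atom a)) → P bot → P top →
    (∀ l ts → (∀ j → P (lookup ts j)) → P (node l ts)) → ∀ t → P t
  Term-induction P a b t n = go
    where
    go  : ∀ t → P t
    gos : ∀ {m} (ts : Vec _ m) j → P (lookup ts j)
    go (atom x)    = a x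
    go bot         = b
    go top         = t
    go (node l ts) = n l ts (gos ts)
    gos (t ∷ ts) zero    = go t
    gos (t ∷ ts) (suc j) = gos ts j

  leaf⁻¹ : ∀ {τ τ′} {a b : A} → Branch {C} τ (atom a) τ′ b → τ ≡ τ′ × a ≡ b
  leaf⁻¹ leaf = refl , refl

  through⁻¹ : ∀ {τ τ′ a} {l : Label C} {ts : Vec (Term C A) (arity l)} →
    Branch τ (node l ts) τ′ a → ∃ λ j → Branch (τ * order l j) (lookup ts j) τ′ a
  through⁻¹ (through j b) = j , b

  branch? : DecidableEquality A → ∀ a τ′ (t : Term C A) τ → Dec (Branch τ t τ′ a)
  branch? _≟_ a τ′ = Term-induction (λ t → ∀ τ → Dec (Branch τ t τ′ a))
    (λ b τ → map′ (λ { (refl , refl) → leaf }) leaf⁻¹ ((τ Sign.≟ τ′) ×-dec (b ≟ a)))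
    (λ _ → no λ ())
    (λ _ → no λ ())
    (λ l ts ih τ → map′ (λ (j , b) → through j b) through⁻¹
                        (Fin.any? λ j → ih j (τ * order l j)))

  opposite-branch : ∀ {τ τ′ a} {t : Term C A} →
    Branch τ t τ′ a → Branch (opposite τ) t (opposite τ′) a
  opposite-branch leaf = leaf
  opposite-branch (through {τ} {l = l} j b) = through j
    (≡.subst (λ σ → Branch σ _ _ _) (opposite-* τ (order l j)) (opposite-branch b))

  positive? : DecidableEquality A → ∀ a (t : Term C A) → Dec (Positive a t)
  positive? _≟_ a t with branch? _≟_ a - t +
  ... | yes b = no λ pos → case pos b of λ ()
  ... | no ¬b = yes λ { {+} _ → refl ; { - } b → contradiction b ¬b }

  negative? : DecidableEquality A → ∀ a (t : Term C A) → Dec (Negative a t)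
  negative? _≟_ a t with branch? _≟_ a + t +
  ... | yes b = no λ neg → case neg b of λ ()
  ... | no ¬b = yes λ { { - } _ → refl ; {+} b → contradiction b ¬b }

  occurs? : DecidableEquality A → ∀ a (t : Term C A) → Dec (Occurs a t)
  occurs? _≟_ a t with branch? _≟_ a - t + | branch? _≟_ a + t +
  ... | yes b | _     = yes (- , b)
  ... | no _  | yes b = yes (+ , b)
  ... | no ¬b | no ¬c = no λ { (+ , b) → ¬c b ; (- , b) → ¬b b }

-- Branches of translated terms

module _ {C D : Connectives} {A B : Set}
         {k : (c : Con C) → Vec (Term D B) (ar C c) → Term D B}
         {ν : A → Term D B} where

  lookup-translates : ∀ {m} (ts : Vec (Term C A) m) j →
    lookup (translates k ν ts) j ≡ translate k ν (lookup ts j)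
  lookup-translates (t ∷ ts) zero    = refl
  lookup-translates (t ∷ ts) (suc j) = lookup-translates ts j

  -- Serves `subst`, `embed` and `Φ` alike. What is asked of `k` is that a branch of `k c ts` be
  -- traceable to a branch of one argument, signed by the order-type of `c`; the path inside
  -- `k c ts` may be longer than one node, as it is for the units.
  translate-branch :
    (∀ c ts {τ τ′ b} → Branch τ (k c ts) τ′ b →
       ∃ λ j → Branch (τ * ot C c j) (lookup ts j) τ′ b) →
    ∀ t {τ τ′ b} → Branch τ (translate k ν t) τ′ b →
    ∃₂ λ a τ″ → Branch τ t τ″ a × Branch τ″ (ν a) τ′ b
  translate-branch k⁻¹ = Term-induction _
    (λ a b → a , _ , leaf , b) (λ ()) (λ ()) λ l ts ih {τ} b →
      let j , b′ = inverse l ts b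
          a , τ″ , b₁ , b₂ = ih j
            (≡.subst (λ t → Branch (τ * order l j) t _ _) (lookup-translates ts j) b′)
      in a , τ″ , through j b₁ , b₂
    where
    inverse : ∀ l ts {τ τ′ b} → Branch τ (translate k ν (node l ts)) τ′ b →
      ∃ λ j → Branch (τ * order l j) (lookup (translates k ν ts) j) τ′ b
    inverse meet    ts = through⁻¹
    inverse join    ts = through⁻¹
    inverse (con c) ts = k⁻¹ c (translates k ν ts)

-- Replacing variable leaves by constants

module _ {C : Connectives} {A : Set} where

  -- Abstracts from the substitution in variable elimination: the inner nodes of both terms agree
  -- position by position, so branches, weights and goodness are compared by recursion on this
  -- relation.
  data _⊒_ : Term C A → Term C A → Set where
    atom : ∀ {a} → atom a ⊒ atom a
    a⊒⊥  : ∀ {a} → atom a ⊒ bot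
    a⊒⊤  : ∀ {a} → atom a ⊒ top
    bot  : bot ⊒ bot
    top  : top ⊒ top
    node : ∀ {l ss ts} → (∀ j → lookup ss j ⊒ lookup ts j) → node l ss ⊒ node l ts

  ⊒-branch : ∀ {s t τ τ′ a} → s ⊒ t → Branch τ t τ′ a → Branch τ s τ′ a
  ⊒-branch atom     b             = b
  ⊒-branch (node r) (through j b) = through j (⊒-branch (r j) b)

  ⊒-subst : (ν : A → Term C A) → (∀ a → atom a ⊒ ν a) → ∀ s → s ⊒ subst ν s
  ⊒-subst ν r = Term-induction _ r bot top λ where
      meet    ts ih → node (step ts ih)
      join    ts ih → node (step ts ih)
      (con c) ts ih → node (step ts ih)
    where
    step : ∀ {m} (ts : Vec _ m) → (∀ j → lookup ts j ⊒ subst ν (lookup ts j)) →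
      ∀ j → lookup ts j ⊒ lookup (translates (λ c → node (con c)) ν ts) j
    step ts ih j = ≡.subst (lookup ts j ⊒_) (sym (lookup-translates ts j)) (ih j)

-- Signed generation trees

module SignedTrees (S : Signature) {n : ℕ} where

  open GenerationTree S

  private
    T : Set
    T = DLE S n

  index⇒1≤ : ∀ {m} → Fin m → 1 ℕ.≤ m
  index⇒1≤ zero    = s≤s z≤n
  index⇒1≤ (suc _) = s≤s z≤n

  SLR? : ∀ τ l → Fin (arity l) → Dec (SLR (τ , l))
  SLR? + meet  j = yes +∧
  SLR? + join  j = no λ ()
  SLR? + (𝒻 f) j = yes (+f (index⇒1≤ j))
  SLR? + (ℊ g) j = no λ ()
  SLR? - meet  j = no λ ()
  SLR? - join  j = yes -∨
  SLR? - (𝒻 f) j = no λ ()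
  SLR? - (ℊ g) j = yes (-g (index⇒1≤ j))

  ΔAdjoint? : ∀ τ l → Dec (ΔAdjoint (τ , l))
  ΔAdjoint? + meet    = yes +∧
  ΔAdjoint? + join    = yes +∨
  ΔAdjoint? - meet    = yes -∧
  ΔAdjoint? - join    = yes -∨
  ΔAdjoint? _ (con _) = no λ ()

  Skeleton? : ∀ τ l → Fin (arity l) → Dec (Skeleton (τ , l))
  Skeleton? τ l j = ΔAdjoint? τ l ⊎-dec SLR? τ l j

  isΔ? : ∀ τ (t : T) → Dec (∃₂ λ α β → t ≡ Δ τ α β)
  isΔ? + (α ∨ β)          = yes (α , β , refl)
  isΔ? + (atom _)         = no λ ()
  isΔ? + bot              = no λ ()
  isΔ? + top              = no λ ()
  isΔ? + (node meet _)    = no λ ()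
  isΔ? + (node (con _) _) = no λ ()
  isΔ? - (α ∧ β)          = yes (α , β , refl)
  isΔ? - (atom _)         = no λ ()
  isΔ? - bot              = no λ ()
  isΔ? - top              = no λ ()
  isΔ? - (node join _)    = no λ ()
  isΔ? - (node (con _) _) = no λ ()

  distribute? : ∀ s τ → Dec (∃ λ (u : T) → Distribute τ s u)
  distribute? = Term-induction _ (λ _ _ → no λ ()) (λ _ → no λ ()) (λ _ → no λ ())
    λ l ts ih τ → map′
      (λ { (j , inj₁ (slr , _ , _ , eq)) → _ , push j slr eq
         ; (j , inj₂ (sk , _ , d))       → _ , within j sk d })
      (λ { (_ , push j slr eq)  → j , inj₁ (slr , _ , _ , eq)
         ; (_ , within j sk d)  → j , inj₂ (sk , _ , d) })
      (Fin.any? λ j → (SLR? τ l j ×-dec isΔ? (τ * order l j) (lookup ts j))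
                        ⊎-dec (Skeleton? τ l j ×-dec ih j (τ * order l j)))

  -- Decreases under every preprocessing step: products dominate the sums into
  -- which Distribute turns them, and a variable outweighs a constant.
  weight : Sign → T → ℕ
  Π      : ∀ {m} → (Fin m → Sign) → Vec T m → ℕ
  weight τ (atom _)    = 2
  weight τ bot         = 1
  weight τ top         = 1
  weight + (α ∨ β)     = 1 ℕ.+ (weight + α ℕ.+ weight + β)
  weight - (α ∧ β)     = 1 ℕ.+ (weight - α ℕ.+ weight - β)
  weight τ (node l ts) = 2 ℕ.* Π (λ j → τ * order l j) ts
  Π σ []       = 1
  Π σ (t ∷ ts) = weight (σ zero) t ℕ.* Π (σ ∘ suc) ts

  1≤weight : ∀ τ t → 1 ℕ.≤ weight τ t
  1≤Π      : ∀ {m} σ (ts : Vec T m) → 1 ℕ.≤ Π σ ts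
  1≤2Π     : ∀ {m} σ (ts : Vec T m) → 1 ℕ.≤ 2 ℕ.* Π σ ts
  1≤weight τ (atom _)          = s≤s z≤n
  1≤weight τ bot               = s≤s z≤n
  1≤weight τ top               = s≤s z≤n
  1≤weight + (α ∨ β)           = s≤s z≤n
  1≤weight + (node meet ts)    = 1≤2Π _ ts
  1≤weight + (node (con _) ts) = 1≤2Π _ ts
  1≤weight - (α ∧ β)           = s≤s z≤n
  1≤weight - (node join ts)    = 1≤2Π _ ts
  1≤weight - (node (con _) ts) = 1≤2Π _ ts
  1≤Π σ []       = s≤s z≤n
  1≤Π σ (t ∷ ts) = ℕ.*-mono-≤ (1≤weight (σ zero) t) (1≤Π (σ ∘ suc) ts)
  1≤2Π σ ts        = ℕ.*-mono-≤ {1} {2} (s≤s z≤n) (1≤Π σ ts)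

  *-mono-<-≤ : ∀ {a b c d} → 1 ℕ.≤ c → a ℕ.< b → c ℕ.≤ d → a ℕ.* c ℕ.< b ℕ.* d
  *-mono-<-≤ {a} {b} {c} {d} (s≤s _) a<b c≤d =
    ℕ.<-≤-trans (ℕ.*-monoˡ-< c a<b) (ℕ.*-monoʳ-≤ b c≤d)

  *-mono-≤-< : ∀ {a b c d} → 1 ℕ.≤ a → a ℕ.≤ b → c ℕ.< d → a ℕ.* c ℕ.< b ℕ.* d
  *-mono-≤-< {a} {b} {c} {d} (s≤s _) a≤b c<d =
    ℕ.<-≤-trans (ℕ.*-monoʳ-< a c<d) (ℕ.*-monoˡ-≤ d a≤b)

  _⊢_≼_ : ∀ {m} → (Fin m → Sign) → Rel (Vec T m) 0ℓ
  σ ⊢ ts ≼ us = ∀ j → weight (σ j) (lookup ts j) ℕ.≤ weight (σ j) (lookup us j)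

  Π-mono-≤ : ∀ {m} σ (ts us : Vec T m) → σ ⊢ ts ≼ us → Π σ ts ℕ.≤ Π σ us
  Π-mono-≤ σ []       []       _ = ℕ.≤-refl
  Π-mono-≤ σ (t ∷ ts) (u ∷ us) r =
    ℕ.*-mono-≤ (r zero) (Π-mono-≤ (σ ∘ suc) ts us (r ∘ suc))

  Π-mono-< : ∀ {m} σ (ts us : Vec T m) → σ ⊢ ts ≼ us → ∀ j →
    weight (σ j) (lookup ts j) ℕ.< weight (σ j) (lookup us j) → Π σ ts ℕ.< Π σ us
  Π-mono-< σ (t ∷ ts) (u ∷ us) r zero    lt =
    *-mono-<-≤ (1≤Π (σ ∘ suc) ts) lt (Π-mono-≤ (σ ∘ suc) ts us (r ∘ suc))
  Π-mono-< σ (t ∷ ts) (u ∷ us) r (suc j) lt =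
    *-mono-≤-< (1≤weight (σ zero) t) (r zero) (Π-mono-< (σ ∘ suc) ts us (r ∘ suc) j lt)

  node-mono-≤ : ∀ τ l ts us → (λ j → τ * order l j) ⊢ ts ≼ us →
    weight τ (node l ts) ℕ.≤ weight τ (node l us)
  node-mono-≤ + join (_ ∷ _ ∷ []) (_ ∷ _ ∷ []) r = s≤s (ℕ.+-mono-≤ (r zero) (r (suc zero)))
  node-mono-≤ - meet (_ ∷ _ ∷ []) (_ ∷ _ ∷ []) r = s≤s (ℕ.+-mono-≤ (r zero) (r (suc zero)))
  node-mono-≤ + meet    ts us r = ℕ.*-monoʳ-≤ 2 (Π-mono-≤ _ ts us r)
  node-mono-≤ + (con _) ts us r = ℕ.*-monoʳ-≤ 2 (Π-mono-≤ _ ts us r)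
  node-mono-≤ - join    ts us r = ℕ.*-monoʳ-≤ 2 (Π-mono-≤ _ ts us r)
  node-mono-≤ - (con _) ts us r = ℕ.*-monoʳ-≤ 2 (Π-mono-≤ _ ts us r)

  node-mono-< : ∀ τ l ts us → (λ j → τ * order l j) ⊢ ts ≼ us → ∀ j →
    weight (τ * order l j) (lookup ts j) ℕ.< weight (τ * order l j) (lookup us j) →
    weight τ (node l ts) ℕ.< weight τ (node l us)
  node-mono-< + join (_ ∷ _ ∷ []) (_ ∷ _ ∷ []) r zero       lt =
    s≤s (ℕ.+-mono-<-≤ lt (r (suc zero)))
  node-mono-< + join (_ ∷ _ ∷ []) (_ ∷ _ ∷ []) r (suc zero) lt =
    s≤s (ℕ.+-mono-≤-< (r zero) lt)
  node-mono-< - meet (_ ∷ _ ∷ []) (_ ∷ _ ∷ []) r zero       lt =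
    s≤s (ℕ.+-mono-<-≤ lt (r (suc zero)))
  node-mono-< - meet (_ ∷ _ ∷ []) (_ ∷ _ ∷ []) r (suc zero) lt =
    s≤s (ℕ.+-mono-≤-< (r zero) lt)
  node-mono-< + meet    ts us r j lt = ℕ.*-monoʳ-< 2 (Π-mono-< _ ts us r j lt)
  node-mono-< + (con _) ts us r j lt = ℕ.*-monoʳ-< 2 (Π-mono-< _ ts us r j lt)
  node-mono-< - join    ts us r j lt = ℕ.*-monoʳ-< 2 (Π-mono-< _ ts us r j lt)
  node-mono-< - (con _) ts us r j lt = ℕ.*-monoʳ-< 2 (Π-mono-< _ ts us r j lt)

  Π-factor : ∀ {m} σ (ts : Vec T m) j →
    ∃ λ c → 1 ℕ.≤ c × (∀ u → Π σ (ts [ j ]≔ u) ≡ weight (σ j) u ℕ.* c)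
  Π-factor σ (t ∷ ts) zero    = Π (σ ∘ suc) ts , 1≤Π (σ ∘ suc) ts , λ _ → refl
  Π-factor σ (t ∷ ts) (suc j) =
    let c , 1≤c , eq = Π-factor (σ ∘ suc) ts j
        a = weight (σ zero) t
    in a ℕ.* c , ℕ.*-mono-≤ (1≤weight (σ zero) t) 1≤c , λ u →
       trans (cong (a ℕ.*_) (eq u)) (swap a (weight (σ (suc j)) u) c)
    where
    swap : ∀ a b c → a ℕ.* (b ℕ.* c) ≡ b ℕ.* (a ℕ.* c)
    swap = solve-∀

  weight-Δ : ∀ τ α β → weight τ (Δ τ α β) ≡ 1 ℕ.+ (weight τ α ℕ.+ weight τ β)
  weight-Δ + α β = refl
  weight-Δ - α β = refl

  weight-SLR : ∀ {τ l} → SLR (τ , l) → ∀ ts →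
    weight τ (node l ts) ≡ 2 ℕ.* Π (λ j → τ * order l j) ts
  weight-SLR +∧     ts = refl
  weight-SLR (+f _) ts = refl
  weight-SLR -∨     ts = refl
  weight-SLR (-g _) ts = refl

  distribute-weight : ∀ {τ s u} → Distribute τ s u → weight τ u ℕ.< weight τ s
  distribute-weight (push {τ} {l} {ts} {α} {β} j slr eq)
    rewrite weight-Δ τ (node l (ts [ j ]≔ α)) (node l (ts [ j ]≔ β))
          | weight-SLR slr (ts [ j ]≔ α) | weight-SLR slr (ts [ j ]≔ β) | weight-SLR slr ts
    with Π-factor (λ j → τ * order l j) ts j
  ... | c , 1≤c , factor
    rewrite factor α | factor β
          | sym (cong (Π (λ j → τ * order l j)) ([]≔-lookup ts j))
          | factor (lookup ts j) | eq | weight-Δ (τ * order l j) α β =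
    -- With `c` the product over the other coordinates, 2(1+a+b)c = 2c + 2ac + 2bc is compared with
    -- 1 + 2ac + 2bc. The factor 2 in `weight` makes 1 < 2c hold even for `c` = 1, for instance at a
    -- unary connective.
    ℕ.<-≤-trans (ℕ.+-monoˡ-≤ rest 1≤c′) (ℕ.≤-reflexive (expand a b c))
    where
    a = weight (τ * order l j) α
    b = weight (τ * order l j) β
    rest = 2 ℕ.* (a ℕ.* c) ℕ.+ 2 ℕ.* (b ℕ.* c)
    1≤c′ : 1 ℕ.< 2 ℕ.* c
    1≤c′ = ℕ.*-monoʳ-≤ 2 1≤c
    expand : ∀ a b c → 2 ℕ.* c ℕ.+ (2 ℕ.* (a ℕ.* c) ℕ.+ 2 ℕ.* (b ℕ.* c)) ≡
                       2 ℕ.* ((1 ℕ.+ (a ℕ.+ b)) ℕ.* c)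
    expand = solve-∀
  distribute-weight (within {τ} {l} {ts} {u} j _ d) =
    node-mono-< τ l (ts [ j ]≔ u) ts le j
      (≡.subst (λ t → weight _ t ℕ.< _) (sym (lookup∘update j ts u)) ih)
    where
    ih = distribute-weight d
    le : (λ j → τ * order l j) ⊢ ts [ j ]≔ u ≼ ts
    le h with h Fin.≟ j
    ... | yes refl rewrite lookup∘update j ts u = ℕ.<⇒≤ ih
    ... | no h≢j rewrite lookup∘update′ h≢j ts u = ℕ.≤-refl

  ⊒-weight : ∀ {s t} → s ⊒ t → ∀ τ → weight τ t ℕ.≤ weight τ s
  ⊒-weight atom τ = ℕ.≤-refl
  ⊒-weight a⊒⊥  τ = s≤s z≤n
  ⊒-weight a⊒⊤  τ = s≤s z≤n
  ⊒-weight bot  τ = ℕ.≤-refl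
  ⊒-weight top  τ = ℕ.≤-refl
  ⊒-weight (node {l} {ss} {ts} r) τ =
    node-mono-≤ τ l ts ss (λ j → ⊒-weight (r j) (τ * order l j))

  -- The branch missing from `t` leads to a variable that was replaced, where the weight drops from
  -- 2 to 1; strict monotonicity carries the drop up to the root.
  ⊒-weight-< : ∀ {s t p τ τ′} → s ⊒ t → Branch τ s τ′ p → ¬ Branch τ t τ′ p →
    weight τ t ℕ.< weight τ s
  ⊒-weight-< atom b ¬b = contradiction b ¬b
  ⊒-weight-< a⊒⊥  b ¬b = s≤s (s≤s z≤n)
  ⊒-weight-< a⊒⊤  b ¬b = s≤s (s≤s z≤n)
  ⊒-weight-< (node {l} {ss} {ts} r) (through {τ} j b) ¬b =
    node-mono-< τ l ts ss (λ j → ⊒-weight (r j) (τ * order l j)) j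
      (⊒-weight-< (r j) b (¬b ∘ through j))

  -- Good critical branches and their preservation

  module Goodness (ε : Fin n → OrderType) (_<_ : Rel (Fin n) 0ℓ) where

    SideCondition : ∀ τ (l : Label (language S)) → Vec T (arity l) → Fin (arity l) → Fin n → Set
    SideCondition τ l ts j i = ∀ h → h ≢ j → ∀ {τ′ k} →
      Branch (τ * order l h) (lookup ts h) τ′ k → τ′ ≡ opposite (ε k) × k < i

    PIABranch : ∀ {τ} {s : T} {τ′ i} → Branch τ s τ′ i → Set
    PIABranch leaf = ⊤
    PIABranch (through {τ} {a = i} {l} {ts} j b) =
      PIA (τ , l) × (SRR (τ , l) → SideCondition τ l ts j i) × PIABranch b

    -- Unlike SRRCondition, this puts no condition on the SRR nodes of the
    -- skeleton part; that stronger condition is not stable under Distribute.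
    GoodBranch : ∀ {τ} {s : T} {τ′ i} → Branch τ s τ′ i → Set
    GoodBranch leaf = ⊤
    GoodBranch b₀@(through {τ} {l = l} j b) = PIABranch b₀ ⊎ (Skeleton (τ , l) × GoodBranch b)

    GoodTree : Sign → T → Set
    GoodTree τ s = ∀ {i} (b : Branch τ s (ε i) i) → GoodBranch b

    PIABranch⇒GoodBranch : ∀ {τ} {s : T} {τ′ i} (b : Branch τ s τ′ i) → PIABranch b → GoodBranch b
    PIABranch⇒GoodBranch leaf          pia = tt
    PIABranch⇒GoodBranch (through j b) pia = inj₁ pia

    inductive⇒good : ∀ {τ s} → InductiveTree _<_ ε τ s → GoodTree τ s
    inductive⇒good ind b =
      let (P₂ , P₁ , eq , sk , pia) , srr = ind b in good b P₂ P₁ eq sk pia srr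
      where
      piaBranch : ∀ {τ} {s : T} {τ′ i} (b : Branch τ s τ′ i) → All PIA (nodes b) →
        SRRCondition _<_ ε b → PIABranch b
      piaBranch leaf          _          _            = tt
      piaBranch (through j b) (pia ∷ ps) (side , srr) = pia , side , piaBranch b ps srr

      good : ∀ {τ} {s : T} {τ′ i} (b : Branch τ s τ′ i) P₂ P₁ → nodes b ≡ P₂ ++ P₁ →
        All Skeleton P₂ → All PIA P₁ → SRRCondition _<_ ε b → GoodBranch b
      good leaf P₂ P₁ eq sk pia srr = tt
      good b@(through _ _) [] P₁ refl sk pia srr = inj₁ (piaBranch b pia srr)
      good (through j b) (x ∷ P₂) P₁ eq (s ∷ sk) pia srr =
        inj₂ ( ≡.subst Skeleton (sym (∷-injectiveˡ eq)) s
             , good b P₂ P₁ (∷-injectiveʳ eq) sk pia (proj₂ srr))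

    good-child : ∀ {τ l ts} → GoodTree τ (node l ts) →
      ∀ j → GoodTree (τ * order l j) (lookup ts j)
    good-child good j b with good (through j b)
    ... | inj₁ (_ , _ , pia) = PIABranch⇒GoodBranch b pia
    ... | inj₂ (_ , g)       = g

    good-node : ∀ {τ l ts} → (Fin (arity l) → Skeleton (τ , l)) →
      (∀ j → GoodTree (τ * order l j) (lookup ts j)) → GoodTree τ (node l ts)
    good-node sk good (through j b) = inj₂ (sk j , good j b)

    good-update : ∀ {m} (σ : Fin m → Sign) (ts : Vec T m) j {u} →
      (∀ h → GoodTree (σ h) (lookup ts h)) → GoodTree (σ j) u →
      ∀ h → GoodTree (σ h) (lookup (ts [ j ]≔ u) h)
    good-update σ ts j {u} good good-u h with h Fin.≟ j
    ... | yes refl rewrite lookup∘update j ts u  = good-u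
    ... | no h≢j rewrite lookup∘update′ h≢j ts u = good h

    Δ-good : ∀ τ {α β} → GoodTree τ α → GoodTree τ β → GoodTree τ (Δ τ α β)
    Δ-good + a b = good-node (λ _ → inj₁ +∨) λ { zero → a ; (suc zero) → b }
    Δ-good - a b = good-node (λ _ → inj₁ -∧) λ { zero → a ; (suc zero) → b }

    good-Δ : ∀ τ {α β} → GoodTree τ (Δ τ α β) → GoodTree τ α × GoodTree τ β
    good-Δ + good = good-child good zero , good-child good (suc zero)
    good-Δ - good = good-child good zero , good-child good (suc zero)

    -- The nodes above the redex, the pushed node and the new `Δ` node are all skeleton nodes, so
    -- goodness of the subtrees below them suffices.
    distribute-good : ∀ {τ s u} → Distribute τ s u → GoodTree τ s → GoodTree τ u
    distribute-good (push {τ} {l} {ts} j slr eq) good =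
      Δ-good τ (node-good (proj₁ both)) (node-good (proj₂ both))
      where
      both = good-Δ (τ * order l j)
        (≡.subst (λ t → GoodTree (τ * order l j) t) eq (good-child good j))
      node-good : ∀ {u} → GoodTree (τ * order l j) u → GoodTree τ (node l (ts [ j ]≔ u))
      node-good g = good-node (λ _ → inj₂ slr) (good-update _ ts j (good-child good) g)
    distribute-good (within {τ} {l} {ts} j sk d) good =
      good-node (λ _ → sk)
        (good-update _ ts j (good-child good) (distribute-good d (good-child good j)))

    ⊒-PIABranch : ∀ {s t : T} {τ τ′ i} (r : s ⊒ t) (b : Branch τ t τ′ i) →
      PIABranch (⊒-branch r b) → PIABranch b
    ⊒-PIABranch atom     leaf          _                  = tt
    ⊒-PIABranch (node r) (through j b) (pia , side , rest) =
      pia , (λ srr h h≢j b′ → side srr h h≢j (⊒-branch (r h) b′)) , ⊒-PIABranch (r j) b rest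

    ⊒-GoodBranch : ∀ {s t : T} {τ τ′ i} (r : s ⊒ t) (b : Branch τ t τ′ i) →
      GoodBranch (⊒-branch r b) → GoodBranch b
    ⊒-GoodBranch atom     leaf          _               = tt
    ⊒-GoodBranch r@(node _) b@(through _ _) (inj₁ pia)  = inj₁ (⊒-PIABranch r b pia)
    ⊒-GoodBranch (node r) (through j b) (inj₂ (sk , g)) = inj₂ (sk , ⊒-GoodBranch (r j) b g)

    ⊒-good : ∀ {τ s t} → s ⊒ t → GoodTree τ s → GoodTree τ t
    ⊒-good r good b = ⊒-GoodBranch r b (good (⊒-branch r b))

-- Polarity and substitution

module _ {C : Connectives} {A : Set} where

  polarity-branch : ∀ {ω a} {t : Term C A} → (∀ {τ} → Branch + t τ a → τ ≡ ω) →
    ∀ {τ τ′} → Branch τ t τ′ a → τ′ ≡ τ * ω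
  polarity-branch pol {+} b = pol b
  polarity-branch pol { - } {τ′} b =
    trans (sym (Sign.opposite-involutive τ′)) (cong opposite (pol (opposite-branch b)))

  subst-branch : ∀ {B : Set} {ν : A → Term C B} (t : Term C A) {τ τ′ b} →
    Branch τ (subst ν t) τ′ b → ∃₂ λ a τ″ → Branch τ t τ″ a × Branch τ″ (ν a) τ′ b
  subst-branch = translate-branch (λ _ _ → through⁻¹)

module Algorithm (S : Signature) (π σ λᵗ ρ : DLE S 1)
  (π⁺ : Positive zero π) (σ⁺ : Positive zero σ)
  (λ⁻ : Negative zero λᵗ) (ρ⁻ : Negative zero ρ) {n : ℕ} where

  open ALBAᵉ S π σ λᵗ ρ
  open GenerationTree (S *ˢ)
  open SignedTrees (S *ˢ) {n}

  unit-branch : ∀ {α : DLE S n} {ω} (θ : DLE S 1) →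
    (∀ {τ} → Branch + θ τ zero → τ ≡ ω) →
    ∀ {τ τ′ k} → Branch τ (θ ⟨ α ⟩) τ′ k → Branch (τ * ω) α τ′ k
  unit-branch θ pol b with subst-branch θ b
  ... | zero , _ , b₁ , b₂ = ≡.subst (λ τ → Branch τ _ _ _) (polarity-branch pol b₁) b₂

  -- Inside a unit such as `π ⟨ θ ⟩` the branch passes through a copy of `θ`, and the polarity of
  -- `π` gives all copies the sign that `θ` has below `◇•`.
  Φ-branch : ∀ (s : DLE* S n) {τ τ′ k} → Branch τ (Φ s) τ′ k → Branch τ s τ′ k
  Φ-branch s b with translate-branch
    (λ where
      (inj₁ (inj₁ f))  ts       b → through⁻¹ b
      (inj₁ (inj₂ ◇•)) (θ ∷ []) b → zero , unit-branch π π⁺ b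
      (inj₁ (inj₂ ◁•)) (θ ∷ []) b → zero , unit-branch λᵗ λ⁻ b
      (inj₂ (inj₁ g))  ts       b → through⁻¹ b
      (inj₂ (inj₂ □•)) (θ ∷ []) b → zero , unit-branch σ σ⁺ b
      (inj₂ (inj₂ ▷•)) (θ ∷ []) b → zero , unit-branch ρ ρ⁻ b) s b
  ... | _ , _ , b′ , leaf = b′

  -- Termination of preprocessing

  data IsConstant : DLE* S n → Set where
    bot : IsConstant bot
    top : IsConstant top

  ⊒-constant : ∀ {c a} → IsConstant c → atom a ⊒ c
  ⊒-constant bot = a⊒⊥
  ⊒-constant top = a⊒⊤

  ⊒-[≔]* : ∀ {c} → IsConstant c → ∀ p s → s ⊒ (s [ p ≔ c ]*)
  ⊒-[≔]* {c} const-c p = ⊒-subst _ λ a → case a Fin.≟ p of λ where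
    (yes refl) → ≡.subst (atom a ⊒_) (sym (updateAt-updates a atom)) (⊒-constant const-c)
    (no a≢p)   → ≡.subst (atom a ⊒_) (sym (updateAt-minimal a p atom a≢p)) atom

  [≔]*-absent : ∀ {c} → IsConstant c → ∀ p s {τ τ′} → ¬ Branch τ (s [ p ≔ c ]*) τ′ p
  [≔]*-absent {c} const-c p s b with subst-branch s b
  ... | a , _ , _ , b′ with a Fin.≟ p
  ...   | yes refl rewrite updateAt-updates a {const c} atom = case const-c , b′ of λ where
          (bot , ())
          (top , ())
  ...   | no a≢p rewrite updateAt-minimal a p {const c} atom a≢p =
          a≢p (proj₂ (leaf⁻¹ b′))

  size : Inequality* n → ℕ
  size (s ≤ t) = weight + s ℕ.+ weight - t

  eliminate-size : ∀ {c} → IsConstant c → ∀ p s t → Occurs p (Φ s) ⊎ Occurs p (Φ t) →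
    size (s [ p ≔ c ]* ≤ t [ p ≔ c ]*) ℕ.< size (s ≤ t)
  eliminate-size const-c p s t = λ where
      (inj₁ (_ , b)) → ℕ.+-mono-<-≤ (lt s (Φ-branch s b)) (le t)
      (inj₂ (_ , b)) → ℕ.+-mono-≤-< (le s) (lt t (opposite-branch (Φ-branch t b)))
    where
    le : ∀ s {τ} → weight τ (s [ p ≔ _ ]*) ℕ.≤ weight τ s
    le s = ⊒-weight (⊒-[≔]* const-c p s) _
    lt : ∀ s {τ τ′} → Branch τ s τ′ p → weight τ (s [ p ≔ _ ]*) ℕ.< weight τ s
    lt s b = ⊒-weight-< (⊒-[≔]* const-c p s) b ([≔]*-absent const-c p s)

  ⟶-size : ∀ {e es} → e ⟶ es → All (λ e′ → size e′ ℕ.< size e) es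
  ⟶-size (distribute-l {t = t} d) = ℕ.+-monoˡ-< (weight - t) (distribute-weight d) ∷ []
  ⟶-size (distribute-r {s = s} d) = ℕ.+-monoʳ-< (weight + s) (distribute-weight d) ∷ []
  ⟶-size (split-∧ {α}) =
    ℕ.+-monoʳ-< (weight + α) (s≤s (ℕ.m≤m+n _ _)) ∷
    ℕ.+-monoʳ-< (weight + α) (s≤s (ℕ.m≤n+m _ _)) ∷ []
  ⟶-size (split-∨ {γ = γ}) =
    ℕ.+-monoˡ-< (weight - γ) (s≤s (ℕ.m≤m+n _ _)) ∷
    ℕ.+-monoˡ-< (weight - γ) (s≤s (ℕ.m≤n+m _ _)) ∷ []
  ⟶-size (eliminate-⊥ {α} {β} p occ _ _) = eliminate-size bot p α β occ ∷ []
  ⟶-size (eliminate-⊤ {α} {β} p occ _ _) =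
    eliminate-size top p β α ([ inj₂ , inj₁ ] occ) ∷ []

  -- Deciding whether a preprocessing step applies

  Eliminable : Fin n → (s t : DLE* S n) → Set
  Eliminable p s t = (Occurs p (Φ s) ⊎ Occurs p (Φ t)) ×
    (Negative p (Φ s) × Positive p (Φ t) ⊎ Positive p (Φ s) × Negative p (Φ t))

  -- The existence of a step, restated as a finite disjunction of decidable conditions; this makes
  -- exhaustion decidable.
  Preprocessable : Inequality* n → Set
  Preprocessable (s ≤ t) =
    ∃ (Distribute + s) ⊎ ∃ (Distribute - t) ⊎
    (∃₂ λ α β → s ≡ Δ + α β) ⊎ (∃₂ λ α β → t ≡ Δ - α β) ⊎
    ∃ λ p → Eliminable p s t

  preprocessable? : ∀ e → Dec (Preprocessable e)
  preprocessable? (s ≤ t) =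
    distribute? s + ⊎-dec distribute? t - ⊎-dec isΔ? + s ⊎-dec isΔ? - t ⊎-dec
    Fin.any? λ p → (occurs? Fin._≟_ p (Φ s) ⊎-dec occurs? Fin._≟_ p (Φ t)) ×-dec
      ((negative? Fin._≟_ p (Φ s) ×-dec positive? Fin._≟_ p (Φ t)) ⊎-dec
       (positive? Fin._≟_ p (Φ s) ×-dec negative? Fin._≟_ p (Φ t)))

  preprocessable⇒⟶ : ∀ {e} → Preprocessable e → ∃ (e ⟶_)
  preprocessable⇒⟶ (inj₁ (_ , d)) = _ , distribute-l d
  preprocessable⇒⟶ (inj₂ (inj₁ (_ , d))) = _ , distribute-r d
  preprocessable⇒⟶ (inj₂ (inj₂ (inj₁ (_ , _ , refl)))) = _ , split-∨
  preprocessable⇒⟶ (inj₂ (inj₂ (inj₂ (inj₁ (_ , _ , refl))))) = _ , split-∧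
  preprocessable⇒⟶ (inj₂ (inj₂ (inj₂ (inj₂ (p , occ , inj₁ (neg , pos)))))) =
    _ , eliminate-⊥ p occ neg pos
  preprocessable⇒⟶ (inj₂ (inj₂ (inj₂ (inj₂ (p , occ , inj₂ (pos , neg)))))) =
    _ , eliminate-⊤ p ([ inj₂ , inj₁ ] occ) pos neg

  ⟶⇒preprocessable : ∀ {e es} → e ⟶ es → Preprocessable e
  ⟶⇒preprocessable (distribute-l d) = inj₁ (_ , d)
  ⟶⇒preprocessable (distribute-r d) = inj₂ (inj₁ (_ , d))
  ⟶⇒preprocessable split-∨ = inj₂ (inj₂ (inj₁ (_ , _ , refl)))
  ⟶⇒preprocessable split-∧ = inj₂ (inj₂ (inj₂ (inj₁ (_ , _ , refl))))
  ⟶⇒preprocessable (eliminate-⊥ p occ neg pos) =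
    inj₂ (inj₂ (inj₂ (inj₂ (p , occ , inj₁ (neg , pos)))))
  ⟶⇒preprocessable (eliminate-⊤ p occ pos neg) =
    inj₂ (inj₂ (inj₂ (inj₂ (p , [ inj₂ , inj₁ ] occ , inj₂ (pos , neg)))))

  step? : ∀ e → Dec (∃ (e ⟶_))
  step? e = map′ preprocessable⇒⟶ (⟶⇒preprocessable ∘ proj₂) (preprocessable? e)

  ⟶ᴸ-++ʳ : ∀ {es es′ : List (Inequality* n)} zs → es ⟶ᴸ es′ → es ++ zs ⟶ᴸ es′ ++ zs
  ⟶ᴸ-++ʳ zs (at {e} {es} xs ys st)
    rewrite ++-assoc xs (e ∷ ys) zs | ++-assoc xs (es ++ ys) zs | ++-assoc es ys zs =
    at xs (ys ++ zs) st

  ⟶ᴸ-++ˡ : ∀ {es es′ : List (Inequality* n)} zs → es ⟶ᴸ es′ → zs ++ es ⟶ᴸ zs ++ es′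
  ⟶ᴸ-++ˡ zs (at {e} {es} xs ys st)
    rewrite sym (++-assoc zs xs (e ∷ ys)) | sym (++-assoc zs xs (es ++ ys)) =
    at (zs ++ xs) ys st

  private
    T Label* Con* : Set
    T      = DLE⁺⁺ S n
    Label* = Label (language (S *ˢ))
    Con*   = Con (language (S *ˢ))

  -- Embedding into DLE⁺⁺

  orient-opposite : ∀ τ (α β : T) → orient τ α β ≡ orient (opposite τ) β α
  orient-opposite 𝟏 α β = refl
  orient-opposite ∂ α β = refl

  -- Turns the embedding of `π ⟨ θ ⟩` into `π ⟪ embed θ ⟫`, the shape on which the adjunction and
  -- approximation rules act.
  embed-subst : ∀ {m} (ν : Fin m → DLE S n) t →
    embed (subst ν t) ≡ translate (λ c → node (con (dle c))) (embed ∘ ν) t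
  embed-substs : ∀ {m k} (ν : Fin m → DLE S n) (ts : Vec (DLE S m) k) →
    translates {D = language⁺⁺ S} (λ c → node (con (dle c))) (λ a → atom (prop a))
      (translates (λ c → node (con c)) ν ts)
    ≡ translates (λ c → node (con (dle c))) (embed ∘ ν) ts
  embed-subst ν (atom a)          = refl
  embed-subst ν bot               = refl
  embed-subst ν top               = refl
  embed-subst ν (node meet ts)    = cong (node meet) (embed-substs ν ts)
  embed-subst ν (node join ts)    = cong (node join) (embed-substs ν ts)
  embed-subst ν (node (con c) ts) = cong (node (con (dle c))) (embed-substs ν ts)
  embed-substs ν []       = refl
  embed-substs ν (t ∷ ts) = cong₂ _∷_ (embed-subst ν t) (embed-substs ν ts)

  embedΦ : DLE* S n → T
  embedΦ s = embed (Φ s)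

  dle-translate-branch : ∀ {A B : Set} {ν : A → Term (language⁺⁺ S) B} (t : Term (language S) A)
    {τ τ′ b} → Branch τ (translate (λ c → node (con (dle c))) ν t) τ′ b →
    ∃₂ λ a τ″ → Branch τ t τ″ a × Branch τ″ (ν a) τ′ b
  dle-translate-branch = translate-branch (λ _ _ → through⁻¹)

  embedΦ-branch : ∀ s {τ τ′ k} → Branch τ (embedΦ s) τ′ (prop k) → Branch τ s τ′ k
  embedΦ-branch s b with dle-translate-branch (Φ s) b
  ... | k , τ″ , b′ , leaf = Φ-branch s b′

  lookup-translates² : ∀ {m} {C D E : Connectives} {X Y Z : Set}
    {k : (c : Con C) → Vec (Term D Y) (ar C c) → Term D Y} {ν : X → Term D Y}
    {k′ : (c : Con D) → Vec (Term E Z) (ar D c) → Term E Z} {ν′ : Y → Term E Z}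
    (ts : Vec (Term C X) m) j →
    lookup (translates k′ ν′ (translates k ν ts)) j ≡ translate k′ ν′ (translate k ν (lookup ts j))
  lookup-translates² {k′ = k′} {ν′ = ν′} ts j =
    trans (lookup-translates (translates _ _ ts) j)
          (cong (translate k′ ν′) (lookup-translates ts j))

  -- Fresh nominals and co-nominals

  family-bound : ∀ {m} (f : Fin m → ℕ) → ∃ λ N → ∀ i → f i ℕ.≤ N
  family-bound {ℕ.zero}  f = 0 , λ ()
  family-bound {ℕ.suc m} f =
    let N , le = family-bound (f ∘ suc) in
    f zero ℕ.⊔ N , λ { zero → ℕ.m≤m⊔n _ _ ; (suc i) → ℕ.m≤n⇒m≤o⊔n _ (le i) }

  name-injective : ∀ ω ω′ {x y} → name {n} ω x ≡ name ω′ y → x ≡ y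
  name-injective 𝟏 𝟏 refl = refl
  name-injective ∂ ∂ refl = refl
  name-injective 𝟏 ∂ ()
  name-injective ∂ 𝟏 ()

  prop≢name : ∀ ω {k x} → prop {n} k ≢ name ω x
  prop≢name 𝟏 ()
  prop≢name ∂ ()

  AvoidsFrom : ℕ → T → Set
  AvoidsFrom N t = ∀ x → N ℕ.≤ x → ∀ ω {τ τ′} → ¬ Branch τ t τ′ (name ω x)

  avoids : ∀ t → ∃ λ N → AvoidsFrom N t
  avoids = Term-induction _
      (λ { (prop k) → 0 , λ x _ ω b → prop≢name ω (proj₂ (leaf⁻¹ b))
         ; (nom j)  → named 𝟏 j
         ; (cnom j) → named ∂ j })
      (0 , λ _ _ _ ()) (0 , λ _ _ _ ())
      λ l ts ih →
        let N , le = family-bound (proj₁ ∘ ih) in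
        N , λ { x N≤x ω (through j b) → proj₂ (ih j) x (ℕ.≤-trans (le j) N≤x) ω b }
    where
    named : ∀ ω j → ∃ λ N → AvoidsFrom N (atom (name ω j))
    named ω j = ℕ.suc j , λ x le ω′ b →
      ℕ.<-irrefl (name-injective ω ω′ (proj₂ (leaf⁻¹ b))) le

  -- A bound instead of a single name, because approximating `f` or `g` takes the block N, N+1, ...
  -- with one name per coordinate. The bound starts at 1 since `𝐢₀` and `𝐦₀` have index 0.
  fresh : (Γ : System n) → ∃ λ N → ∀ x → N ℕ.≤ x → ∀ ω → Fresh (name ω x) Γ
  fresh [] = 1 , λ where
    x 1≤x ω → (λ eq → ℕ.<-irrefl (sym (name-injective ω 𝟏 eq)) 1≤x)
            , (λ eq → ℕ.<-irrefl (sym (name-injective ω ∂ eq)) 1≤x) , []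
  fresh ((_ , β ≤ γ) ∷ Γ) =
    let M , fr   = fresh Γ
        N , av   = avoids β
        N′ , av′ = avoids γ
    in M ℕ.⊔ (N ℕ.⊔ N′) , λ x le ω →
       let i₀ , m₀ , rest = fr x (ℕ.m⊔n≤o⇒m≤o M _ le) ω
           le′ = ℕ.m⊔n≤o⇒n≤o M _ le
       in i₀ , m₀ ,
          ((λ (_ , b) → av x (ℕ.m⊔n≤o⇒m≤o N _ le′) ω b) ,
           (λ (_ , b) → av′ x (ℕ.m⊔n≤o⇒n≤o N _ le′) ω b)) ∷ rest

  -- Runs

  -- Quantifying over permutations builds in that systems are read up to order, so no run has to be
  -- transported along a permutation.
  Solvable : System n → Set
  Solvable Γ = ∀ Γ′ → Γ′ ↭ Γ → Σ (Run Γ′) λ r → SafeRun r × SuccessfulRun r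

  solve-all : ∀ {Γs} → All Solvable Γs → Σ (All Run Γs) λ rs → SafeRuns rs × SuccessfulRuns rs
  solve-all [] = [] , tt , tt
  solve-all (s ∷ ss) =
    let r , safe , success = s _ ↭-refl
        rs , safes , successes = solve-all ss
    in r ∷ rs , (safe , safes) , (success , successes)

  solve-step : ∀ {Γ Γs} (x : Γ ⇒ Γs) → SafeStep x → All Solvable Γs →
    Σ (Run Γ) λ r → SafeRun r × SuccessfulRun r
  solve-step x safe ss =
    let rs , safes , successes = solve-all ss in step x rs , (safe , safes) , successes

  module Ordered (ε : Fin n → OrderType) (_<_ : Rel (Fin n) 0ℓ)
    (irrefl : Irreflexive _≡_ _<_) (<-trans : Transitive _<_) where

    open Goodness ε _<_

    -- Preprocessing to exhausted good inequalities

    GoodInequality : Inequality* n → Set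
    GoodInequality (s ≤ t) = GoodTree + s × GoodTree - t

    ⟶-good : ∀ {e es} → e ⟶ es → GoodInequality e → All GoodInequality es
    ⟶-good (distribute-l d) (gs , gt) = (distribute-good d gs , gt) ∷ []
    ⟶-good (distribute-r d) (gs , gt) = (gs , distribute-good d gt) ∷ []
    ⟶-good split-∧ (gs , gt) =
      (gs , good-child gt zero) ∷ (gs , good-child gt (suc zero)) ∷ []
    ⟶-good split-∨ (gs , gt) =
      (good-child gs zero , gt) ∷ (good-child gs (suc zero) , gt) ∷ []
    ⟶-good (eliminate-⊥ p _ _ _) (gs , gt) =
      (⊒-good (⊒-[≔]* bot p _) gs , ⊒-good (⊒-[≔]* bot p _) gt) ∷ []
    ⟶-good (eliminate-⊤ p _ _ _) (gs , gt) =
      (⊒-good (⊒-[≔]* top p _) gs , ⊒-good (⊒-[≔]* top p _) gt) ∷ []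

    Preprocessed : List (Inequality* n) → Set
    Preprocessed es = ∃ λ es′ → Star _⟶ᴸ_ es es′ × All (λ e → Exhausted e × GoodInequality e) es′

    preprocess-all : ∀ {es} → All (λ e → Preprocessed (e ∷ [])) es → Preprocessed es
    preprocess-all [] = [] , Star.ε , []
    preprocess-all {_ ∷ es} ((xs , r , x) ∷ rest) =
      let ys , rs , y = preprocess-all rest in
      xs ++ ys ,
      Star.gmap (_++ es) (⟶ᴸ-++ʳ es) r ◅◅ Star.gmap (xs ++_) (⟶ᴸ-++ˡ xs) rs ,
      All.++⁺ x y

    -- Each inequality produced by a step recurses on its own size, and the resulting reductions are
    -- concatenated; so no measure on lists is involved.
    preprocess : ∀ e → GoodInequality e → Preprocessed (e ∷ [])
    preprocess e = go e (<-wellFounded (size e))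
      where
      go : ∀ e → Acc ℕ._<_ (size e) → GoodInequality e → Preprocessed (e ∷ [])
      go e (acc rs) good with step? e
      ... | no stuck = e ∷ [] , Star.ε , ((λ st → stuck (_ , st)) , good) ∷ []
      ... | yes (es , st) =
        let es′ , r , x = preprocess-all
              (All.zipWith (λ (lt , g) → go _ (rs lt) g) (⟶-size st , ⟶-good st good))
        in es′ , ≡.subst ((e ∷ []) ⟶ᴸ_) (++-identityʳ es) (at [] [] st) ◅ r , x

    -- Non-critical leaves and reducible inequalities

    -- The condition that `ε^∂(t)` holds under the sign `τ`, together with a bound `P` on the
    -- variables: `U`, `_< i`, or membership among the variables not yet eliminated. Nominals and
    -- co-nominals are unrestricted.
    Leaves : Sign → T → (Fin n → Set) → Set
    Leaves τ t P = ∀ τ′ k → Branch τ t τ′ (prop k) → τ′ ≡ opposite (ε k) × P k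

    Leaves-map : ∀ {τ t} {P Q : Fin n → Set} → (∀ {k} → P k → Q k) → Leaves τ t P → Leaves τ t Q
    Leaves-map f L τ′ k b = let eq , p = L τ′ k b in eq , f p

    node-leaves : ∀ {τ} {l : Label (language⁺⁺ S)} {ts P} →
      (∀ j → Leaves (τ * order l j) (lookup ts j) P) → Leaves τ (node l ts) P
    node-leaves L τ′ k (through j b) = L j τ′ k b

    name-leaves : ∀ {τ P} ω x → Leaves τ (atom (name ω x)) P
    name-leaves ω x τ′ k b = contradiction (sym (proj₂ (leaf⁻¹ b))) (prop≢name ω)

    embedΦ-leaves : ∀ {τ} {s : DLE* S n} {P} →
      (∀ τ′ k → Branch τ s τ′ k → τ′ ≡ opposite (ε k) × P k) → Leaves τ (embedΦ s) P
    embedΦ-leaves {s = s} L τ′ k b = L τ′ k (embedΦ-branch s b)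

    unit-leaves : ∀ {τ α P} (θ : DLE S 1) → (∀ {τ} → Leaves τ α P) → Leaves τ (θ ⟪ α ⟫) P
    unit-leaves θ L τ′ k b with dle-translate-branch θ b
    ... | _ , _ , _ , b′ = L τ′ k b′

    -- The two kinds of inequalities that are left before the Ackermann rules:
    -- α ≤ p_i (resp. p_i ≤ α), and those which receive the substitutions.
    data Done (R C : Fin n → Set) : Item n → Set where
      critical  : ∀ {i α} → C i → Leaves (opposite (ε i)) α (λ k → R k × k < i) →
                  Done R C (ordinary , orient (ε i) α (atom (prop i)))
      receiving : ∀ {st e} → Leaves - (lhs e) R → Leaves + (rhs e) R → Done R C (st , e)

    oriented : ∀ {R C : Fin n → Set} {st} τ {χ s} → Leaves (opposite τ) χ R → Leaves τ s R →
      Done R C (st , orient τ χ s)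
    oriented 𝟏 Lχ Ls = receiving Lχ Ls
    oriented ∂ Lχ Ls = receiving Ls Lχ

    -- In continuation-passing style, since an approximation rule duplicates the
    -- rest of the system.
    Reducible : Item n → Set
    Reducible x = ∀ Θ → (∀ Δ → All (Done U U) Δ → Solvable (Δ ++ Θ)) → Solvable (x ∷ Θ)

    reducible-cong : ∀ {st τ χ t t′} → t ≡ t′ →
      Reducible (st , orient τ χ t) → Reducible (st , orient τ χ t′)
    reducible-cong refl r = r

    done⇒reducible : ∀ {x} → Done U U x → Reducible x
    done⇒reducible d Θ k = k (_ ∷ []) (d ∷ [])

    reduce-all : ∀ {Γ} → All Reducible Γ → ∀ Θ →
      (∀ Δ → All (Done U U) Δ → Solvable (Δ ++ Θ)) → Solvable (Γ ++ Θ)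
    reduce-all [] Θ k = k [] []
    reduce-all {_ ∷ Γ} (r ∷ rs) Θ k = r (Γ ++ Θ) λ Δ ds _ Γ′↭ →
      reduce-all rs (Δ ++ Θ)
        (λ Δ′ ds′ _ Γ″↭ → k (Δ′ ++ Δ) (All.++⁺ ds′ ds) _
          (↭-trans Γ″↭ (↭-reflexive (sym (++-assoc Δ′ Δ Θ)))))
        _ (↭-trans Γ′↭ (shifts Δ Γ))

    reduce-local : ∀ {e} → (∀ Γ → ∃ λ Δs → Rule Γ e Δs × All (All Reducible) Δs) →
      Reducible (ordinary , e)
    reduce-local rule Θ k Γ Γ↭ =
      let Δs , r , reds = rule Γ in
      solve-step (local Γ↭ r) refl (All.map⁺ (All.map (λ red → reduce-all red Θ k) reds))

    reduce₁ : ∀ {e Δ} → (∀ {Γ} → Rule Γ e (Δ ∷ [])) → All Reducible Δ → Reducible (ordinary , e)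
    reduce₁ r reds = reduce-local λ _ → _ , r , reds ∷ []

    critical? : ∀ τ (s : DLE* S n) → Dec (∃ λ i → Branch τ s (ε i) i)
    critical? τ s = Fin.any? λ i → branch? Fin._≟_ i (ε i) s τ

    noncritical-leaves : ∀ {τ} {s : DLE* S n} →
      ¬ (∃ λ i → Branch τ s (ε i) i) → Leaves τ (embedΦ s) U
    noncritical-leaves {τ} {s} ¬crit = embedΦ-leaves {s = s} λ τ′ k b →
      ≢⇒≡opposite (λ { refl → ¬crit (k , b) }) , tt

    unique-index : ∀ {m} → m ≡ 1 → (h j : Fin m) → h ≡ j
    unique-index refl zero zero = refl

    -- An SRA connective is unary and has no side arguments, so it can be treated like an SRR one.
    con-side : ∀ {τ} {c : Con*} {ts j i} → PIA (τ , con c) →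
      (SRR (τ , con c) → SideCondition τ (con c) ts j i) → SideCondition τ (con c) ts j i
    con-side (inj₁ (+g eq)) cond h h≢j = contradiction (unique-index eq h _) h≢j
    con-side (inj₁ (-f eq)) cond h h≢j = contradiction (unique-index eq h _) h≢j
    con-side (inj₂ srr)     cond       = cond srr

    residual-sign : ∀ τ o → opposite (τ * o) * o ≡ opposite τ
    residual-sign + + = refl
    residual-sign + - = refl
    residual-sign - + = refl
    residual-sign - - = refl

    residual-sign′ : ∀ τ o o′ → opposite (τ * o) * opposite (o * o′) ≡ τ * o′
    residual-sign′ + + + = refl
    residual-sign′ + + - = refl
    residual-sign′ + - + = refl
    residual-sign′ + - - = refl
    residual-sign′ - + + = refl
    residual-sign′ - + - = refl
    residual-sign′ - - + = refl
    residual-sign′ - - - = refl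

    -- Residuation preserves signs: the residual itself is signed `opposite (τ * ω j)`, and its
    -- order-type returns the sign `opposite τ` to `χ` and `τ * ω h` to each side argument.
    residual-leaves : ∀ {τ m χ P} (ω : Fin m → OrderType) (ψs : Vec T m) j →
      Leaves (opposite τ) χ P → (∀ h → h ≢ j → Leaves (τ * ω h) (lookup ψs h) P) →
      ∀ h → Leaves (opposite (τ * ω j) * residual ω j h) (lookup (ψs [ j ]≔ χ) h) P
    residual-leaves {τ} {χ = χ} ω ψs j Lχ Lψ h with h Fin.≟ j
    ... | yes refl rewrite lookup∘update j ψs χ
                         | updateAt-updates j {const (ω j)} (λ i → opposite (ω j * ω i))
                         | residual-sign τ (ω j) = Lχ
    ... | no h≢j rewrite lookup∘update′ h≢j ψs χ
                       | updateAt-minimal h j {const (ω j)} (λ i → opposite (ω j * ω i)) h≢j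
                       | residual-sign′ τ (ω j) (ω h) = Lψ h h≢j

    -- Reduction to displayed inequalities

    -- `χ` accumulates the side arguments already moved across. Its variables must lie below every
    -- `p_i` that `s` may still display, since each of these may end up facing `χ`.
    Displayable : Sign → T → DLE* S n → Set
    Displayable τ χ s = ∀ i (b : Branch τ s (ε i) i) →
      PIABranch b × Leaves (opposite τ) χ (_< i)

    -- `Leaves (opposite τ) χ U` is a separate premise because `Displayable` is vacuous when `s` has
    -- no critical leaf, whereas the inequality must still be fit to receive substitutions.
    Display : DLE* S n → Set
    Display s = ∀ τ χ → Leaves (opposite τ) χ U → Displayable τ χ s →
      Reducible (ordinary , orient τ χ (embedΦ s))

    displayable-child : ∀ {τ χ} {l : Label*} {ts} → Displayable τ χ (node l ts) → ∀ j χ′ →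
      (∀ {i} → PIA (τ , l) → (SRR (τ , l) → SideCondition τ l ts j i) →
         Leaves (opposite τ) χ (_< i) → Leaves (opposite (τ * order l j)) χ′ (_< i)) →
      Displayable (τ * order l j) χ′ (lookup ts j)
    displayable-child D j χ′ f i b =
      let (pia , cond , rest) , L = D i (through j b) in rest , f pia cond L

    -- The critical branch in the child is what shows `χ′` to be non-critical: the side arguments in
    -- `χ′` are constrained only through the critical branches that pass by them.
    continue : ∀ {τ χ} {l : Label*} {ts} → Displayable τ χ (node l ts) →
      ∀ j χ′ → Display (lookup ts j) →
      (∀ {i} → PIA (τ , l) → (SRR (τ , l) → SideCondition τ l ts j i) →
         Leaves (opposite τ) χ (_< i) → Leaves (opposite (τ * order l j)) χ′ (_< i)) →
      ∀ {i} → Branch (τ * order l j) (lookup ts j) (ε i) i →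
      Reducible (ordinary , orient (τ * order l j) χ′ (embedΦ (lookup ts j)))
    continue {τ} {l = l} D j χ′ display-j f {i} b =
      display-j (τ * order l j) χ′ (Leaves-map (λ _ → tt) (proj₂ (D′ i b))) D′
      where
      D′ = displayable-child D j χ′ f

    side-leaves : ∀ {τ} {c : Con*} {ts j i} → PIA (τ , con c) →
      (SRR (τ , con c) → SideCondition τ (con c) ts j i) → ∀ {ψs} →
      (∀ h → lookup ψs h ≡ embedΦ (lookup ts h)) →
      ∀ h → h ≢ j → Leaves (τ * ot (language (S *ˢ)) c h) (lookup ψs h) (_< i)
    side-leaves {ts = ts} pia cond eq h h≢j = ≡.subst (λ t → Leaves _ t _) (sym (eq h))
      (embedΦ-leaves {s = lookup ts h} λ _ _ → con-side {ts = ts} pia cond h h≢j)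

    display-g : ∀ {χ g} {ts : Vec (DLE* S n) (ar (G S) g)} {ψs} →
      (∀ h → lookup ψs h ≡ embedΦ (lookup ts h)) → (∀ j → Display (lookup ts j)) →
      Displayable + χ (node (ℊ (inj₁ g)) ts) →
      ∀ {i} j → Branch (ot (G S) g j) (lookup ts j) (ε i) i →
      Reducible (ordinary , χ ≤ node (con (dle (inj₂ g))) ψs)
    display-g {χ} {g} {ts} {ψs} eq ih D j b = reduce₁ (residuate-g j)
      (reducible-cong (sym (eq j))
        (continue D j (node (con (resG g j)) (ψs [ j ]≔ χ)) (ih j) (λ pia cond L →
          node-leaves (residual-leaves (ot (G S) g) ψs j L
            (side-leaves {ts = ts} pia cond {ψs} eq))) b)
      ∷ [])

    display-f : ∀ {χ f} {ts : Vec (DLE* S n) (ar (F S) f)} {ψs} →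
      (∀ h → lookup ψs h ≡ embedΦ (lookup ts h)) → (∀ j → Display (lookup ts j)) →
      Displayable - χ (node (𝒻 (inj₁ f)) ts) →
      ∀ {i} j → Branch (opposite (ot (F S) f j)) (lookup ts j) (ε i) i →
      Reducible (ordinary , node (con (dle (inj₁ f))) ψs ≤ χ)
    display-f {χ} {f} {ts} {ψs} eq ih D j b = reduce₁ (residuate-f j)
      (≡.subst (λ e → Reducible (ordinary , e)) (sym (orient-opposite (ot (F S) f j) _ _))
        (reducible-cong (sym (eq j))
          (continue D j (node (con (resF f j)) (ψs [ j ]≔ χ)) (ih j) (λ pia cond L →
            node-leaves (residual-leaves (ot (F S) f) ψs j L
            (side-leaves {ts = ts} pia cond {ψs} eq))) b))
      ∷ [])

    display : ∀ s → Display s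
    display = Term-induction Display display-atom (display-noncritical λ { _ (_ , ()) })
      (display-noncritical λ { _ (_ , ()) }) display-node
      where
      display-noncritical : ∀ {s : DLE* S n} → (∀ τ → ¬ (∃ λ i → Branch τ s (ε i) i)) → Display s
      display-noncritical {s} ¬crit τ χ Lχ _ =
        done⇒reducible (oriented τ Lχ (noncritical-leaves {s = s} (¬crit τ)))

      display-atom : ∀ i → Display (atom i)
      display-atom i τ χ Lχ D with τ Sign.≟ ε i
      ... | yes refl = done⇒reducible (critical tt
              (Leaves-map (tt ,_) (proj₂ (D i leaf))))
      ... | no τ≢ = done⇒reducible (oriented τ Lχ λ where
              _ _ leaf → ≢⇒≡opposite τ≢ , tt)

      display-node : ∀ l ts → (∀ j → Display (lookup ts j)) → Display (node l ts)
      display-node l ts ih τ χ Lχ D with critical? τ (node l ts)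
      ... | no ¬crit = done⇒reducible
              (oriented τ Lχ (noncritical-leaves {s = node l ts} ¬crit))
      ... | yes (i , through j b) = main τ l ts ih Lχ D j b
        where
        main : ∀ τ {χ} (l : Label*) ts → (∀ j → Display (lookup ts j)) → Leaves (opposite τ) χ U →
          Displayable τ χ (node l ts) → ∀ {i} j → Branch (τ * order l j) (lookup ts j) (ε i) i →
          Reducible (ordinary , orient τ χ (embedΦ (node l ts)))
        -- Splitting does not change `χ`, so both halves can be displayed, including one without a
        -- critical leaf.
        main + {χ} meet (α ∷ β ∷ []) ih Lχ D j b = reduce₁ split-∧
          ( ih zero + χ Lχ (displayable-child D zero χ λ _ _ L → L)
          ∷ ih (suc zero) + χ Lχ (displayable-child D (suc zero) χ λ _ _ L → L) ∷ [])
        main - {χ} join (α ∷ β ∷ []) ih Lχ D j b = reduce₁ split-∨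
          ( ih zero - χ Lχ (displayable-child D zero χ λ _ _ L → L)
          ∷ ih (suc zero) - χ Lχ (displayable-child D (suc zero) χ λ _ _ L → L) ∷ [])
        main + join (α ∷ β ∷ []) ih Lχ D zero b = reduce₁ residuate-∨₂
          (continue D zero _ (ih zero) (λ _ cond L → node-leaves λ where
            zero       → L
            (suc zero) → embedΦ-leaves {s = β} λ _ _ → cond +∨ (suc zero) λ ()) b ∷ [])
        main + join (α ∷ β ∷ []) ih Lχ D (suc zero) b = reduce₁ residuate-∨₁
          (continue D (suc zero) _ (ih (suc zero)) (λ _ cond L → node-leaves λ where
            zero       → L
            (suc zero) → embedΦ-leaves {s = α} λ _ _ → cond +∨ zero λ ()) b ∷ [])
        main - meet (α ∷ β ∷ []) ih Lχ D zero b = reduce₁ residuate-∧₁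
          (continue D zero _ (ih zero) (λ _ cond L → node-leaves λ where
            zero       → embedΦ-leaves {s = β} λ _ _ → cond -∧ (suc zero) λ ()
            (suc zero) → L) b ∷ [])
        main - meet (α ∷ β ∷ []) ih Lχ D (suc zero) b = reduce₁ residuate-∧₂
          (continue D (suc zero) _ (ih (suc zero)) (λ _ cond L → node-leaves λ where
            zero       → embedΦ-leaves {s = α} λ _ _ → cond -∧ zero λ ()
            (suc zero) → L) b ∷ [])
        main + (ℊ (inj₁ g)) ts ih Lχ D j b = display-g (lookup-translates² ts) ih D j b
        main - (𝒻 (inj₁ f)) ts ih Lχ D j b = display-f (lookup-translates² ts) ih D j b
        -- The constant unit `σ ⟪ top ⟫` has no variables, so the side condition has only the
        -- non-critical leaves of `χ` and counts as finished immediately; this is what keeps the run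
        -- safe. The other three units behave likewise.
        main + (ℊ (inj₂ □•)) (α ∷ []) ih Lχ D zero b rewrite embed-subst (const (Φ α)) σ =
          reduce₁ adjunction-σ
            ( done⇒reducible (receiving Lχ (unit-leaves σ λ _ _ ()))
            ∷ continue D zero _ (ih zero) (λ _ _ L → node-leaves λ { zero → L }) b ∷ [])
        main + (ℊ (inj₂ ▷•)) (α ∷ []) ih Lχ D zero b rewrite embed-subst (const (Φ α)) ρ =
          reduce₁ adjunction-ρ
            ( done⇒reducible (receiving Lχ (unit-leaves ρ λ _ _ ()))
            ∷ continue D zero _ (ih zero) (λ _ _ L → node-leaves λ { zero → L }) b ∷ [])
        main - (𝒻 (inj₂ ◇•)) (α ∷ []) ih Lχ D zero b rewrite embed-subst (const (Φ α)) π =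
          reduce₁ adjunction-π
            ( done⇒reducible (receiving (unit-leaves π λ _ _ ()) Lχ)
            ∷ continue D zero _ (ih zero) (λ _ _ L → node-leaves λ { zero → L }) b ∷ [])
        main - (𝒻 (inj₂ ◁•)) (α ∷ []) ih Lχ D zero b rewrite embed-subst (const (Φ α)) λᵗ =
          reduce₁ adjunction-λ
            ( done⇒reducible (receiving (unit-leaves λᵗ λ _ _ ()) Lχ)
            ∷ continue D zero _ (ih zero) (λ _ _ L → node-leaves λ { zero → L }) b ∷ [])
        main + (𝒻 f) ts ih Lχ D j b = case proj₁ (proj₁ (D _ (through j b))) of λ where
          (inj₁ ())
          (inj₂ ())
        main - (ℊ g) ts ih Lχ D j b = case proj₁ (proj₁ (D _ (through j b))) of λ where
          (inj₁ ())
          (inj₂ ())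

    -- Approximation through the skeleton

    -- A `Δ` node at the root is not a redex of `Distribute`; there it is excluded by exhausted
    -- splitting. Below an SLR node it would be a redex of `push`, so the property passes to the
    -- children.
    Approximable : Sign → DLE* S n → Set
    Approximable τ s =
      GoodTree τ s × (∀ u → ¬ Distribute τ s u) × (∀ α β → s ≢ Δ τ α β)

    Approximate : DLE* S n → Set
    Approximate s = ∀ τ x → Approximable τ s →
      Reducible (ordinary , orient τ (atom (name τ x)) (embedΦ s))

    approximable-child : ∀ {τ} {l : Label*} {ts} → SLR (τ , l) →
      Approximable τ (node l ts) → ∀ j → Approximable (τ * order l j) (lookup ts j)
    approximable-child slr (good , nf , _) j =
      good-child good j , (λ _ d → nf _ (within j (inj₂ slr) d)) , (λ _ _ eq → nf _ (push j slr eq))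

    -- A nominal or co-nominal has no propositional leaf, so all bounds on the opposite side hold
    -- vacuously.
    display-name : ∀ s τ x → (∀ i (b : Branch τ s (ε i) i) → PIABranch b) →
      Reducible (ordinary , orient τ (atom (name τ x)) (embedΦ s))
    display-name s τ x pia =
      display s τ _ (name-leaves τ x) λ i b → pia i b , name-leaves τ x

    display-PIA : ∀ τ (l : Label*) ts x → ¬ Skeleton (τ , l) →
      GoodTree τ (node l ts) →
      Reducible (ordinary , orient τ (atom (name τ x)) (embedΦ (node l ts)))
    display-PIA τ l ts x ¬sk good = display-name (node l ts) τ x λ where
      i (through j b) → case good (through j b) of λ where
        (inj₁ pia)      → pia
        (inj₂ (sk , _)) → contradiction sk ¬sk

    name-args : ∀ {m τ} {ω : Fin m → OrderType} {x : Fin m → ℕ} {P} j →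
      Leaves τ (lookup (Vec.tabulate (λ k → atom (name (ω k) (x k)))) j) P
    name-args {ω = ω} {x} j
      rewrite lookup∘tabulate {A = T} (λ k → atom (name (ω k) (x k))) j = name-leaves (ω j) (x j)

    names-injective : ∀ {m N} (ω : Fin m → OrderType) {j k} →
      name {n} (ω j) (N ℕ.+ toℕ j) ≡ name (ω k) (N ℕ.+ toℕ k) → j ≡ k
    names-injective {N = N} ω {j} {k} eq =
      Fin.toℕ-injective (ℕ.+-cancelˡ-≡ N _ _ (name-injective (ω j) (ω k) eq))

    approximate-F : ∀ {f} {ts : Vec (DLE* S n) (ar (F S) f)} {ψs} →
      (∀ h → lookup ψs h ≡ embedΦ (lookup ts h)) → (∀ j → Approximate (lookup ts j)) →
      ∀ x → Approximable + (node (𝒻 (inj₁ f)) ts) →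
      Reducible (ordinary , atom (nom x) ≤ node (con (dle (inj₁ f))) ψs)
    approximate-F {f} {ts} {ψs} eq ih x ap = reduce-local λ Γ →
      let N , fr = fresh Γ in
      _ , approximate-f (λ k → N ℕ.+ toℕ k) (names-injective (ot (F S) f))
            (λ k → fr _ (ℕ.m≤m+n N _) (ot (F S) f k)) ,
      (done⇒reducible (receiving (name-leaves 𝟏 x) (node-leaves λ j → name-args j))
       ∷ All.tabulate⁺ λ k → reducible-cong (sym (eq k))
           (ih k (ot (F S) f k) (N ℕ.+ toℕ k)
             (approximable-child (+f (index⇒1≤ k)) ap k))) ∷ []

    approximate-G : ∀ {g} {ts : Vec (DLE* S n) (ar (G S) g)} {ψs} →
      (∀ h → lookup ψs h ≡ embedΦ (lookup ts h)) → (∀ j → Approximate (lookup ts j)) →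
      ∀ x → Approximable - (node (ℊ (inj₁ g)) ts) →
      Reducible (ordinary , node (con (dle (inj₂ g))) ψs ≤ atom (cnom x))
    approximate-G {g} {ts} {ψs} eq ih x ap = reduce-local λ Γ →
      let N , fr = fresh Γ in
      _ , approximate-g (λ k → N ℕ.+ toℕ k) (names-injective (opposite ∘ ot (G S) g))
            (λ k → fr _ (ℕ.m≤m+n N _) (opposite (ot (G S) g k))) ,
      (done⇒reducible (receiving (node-leaves λ j → name-args j) (name-leaves ∂ x))
       ∷ All.tabulate⁺ λ k →
           ≡.subst (λ e → Reducible (ordinary , e)) (sym (orient-opposite (ot (G S) g k) _ _))
             (reducible-cong (sym (eq k))
               (ih k (opposite (ot (G S) g k)) (N ℕ.+ toℕ k)
                 (approximable-child (-g (index⇒1≤ k)) ap k)))) ∷ []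

    approximate : ∀ s → Approximate s
    approximate = Term-induction Approximate
      (λ i τ x _ → display-name (atom i) τ x λ { _ leaf → tt })
      (λ τ x _ → display-name bot τ x λ _ ())
      (λ τ x _ → display-name top τ x λ _ ())
      λ l ts ih τ x ap → main τ l ts ih x ap
      where
      main : ∀ τ (l : Label*) ts → (∀ j → Approximate (lookup ts j)) →
        ∀ x → Approximable τ (node l ts) →
        Reducible (ordinary , orient τ (atom (name τ x)) (embedΦ (node l ts)))
      main + meet (α ∷ β ∷ []) ih x ap = reduce₁ split-∧
        ( ih zero + x (approximable-child +∧ ap zero)
        ∷ ih (suc zero) + x (approximable-child +∧ ap (suc zero)) ∷ [])
      main - join (α ∷ β ∷ []) ih x ap = reduce₁ split-∨
        ( ih zero - x (approximable-child -∨ ap zero)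
        ∷ ih (suc zero) - x (approximable-child -∨ ap (suc zero)) ∷ [])
      main + join (α ∷ β ∷ []) ih x (_ , _ , ¬Δ) = contradiction refl (¬Δ α β)
      main - meet (α ∷ β ∷ []) ih x (_ , _ , ¬Δ) = contradiction refl (¬Δ α β)
      main + (𝒻 (inj₁ f)) ts ih x ap = approximate-F (lookup-translates² ts) ih x ap
      main - (ℊ (inj₁ g)) ts ih x ap = approximate-G (lookup-translates² ts) ih x ap
      main + (𝒻 (inj₂ ◇•)) (α ∷ []) ih x ap rewrite embed-subst (const (Φ α)) π =
        reduce-local λ Γ → let N , fr = fresh Γ in
          _ , approximate-π N (fr N ℕ.≤-refl 𝟏) ,
          -- The first of the two systems needs no further reduction of this inequality, `π ⟪ bot ⟫`
          -- being free of variables; the second goes on with the argument.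
          (done⇒reducible (receiving (name-leaves 𝟏 x) (unit-leaves π λ _ _ ())) ∷ [])
          ∷ (ih zero + N (approximable-child (+f (s≤s z≤n)) ap zero)
             ∷ done⇒reducible (receiving (name-leaves 𝟏 x)
                 (node-leaves λ { zero → name-leaves 𝟏 N })) ∷ [])
          ∷ []
      main + (𝒻 (inj₂ ◁•)) (α ∷ []) ih x ap rewrite embed-subst (const (Φ α)) λᵗ =
        reduce-local λ Γ → let N , fr = fresh Γ in
          _ , approximate-λ N (fr N ℕ.≤-refl ∂) ,
          (done⇒reducible (receiving (name-leaves 𝟏 x) (unit-leaves λᵗ λ _ _ ())) ∷ [])
          ∷ (ih zero - N (approximable-child (+f (s≤s z≤n)) ap zero)
             ∷ done⇒reducible (receiving (name-leaves 𝟏 x)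
                 (node-leaves λ { zero → name-leaves ∂ N })) ∷ [])
          ∷ []
      main - (ℊ (inj₂ □•)) (α ∷ []) ih x ap rewrite embed-subst (const (Φ α)) σ =
        reduce-local λ Γ → let N , fr = fresh Γ in
          _ , approximate-σ N (fr N ℕ.≤-refl ∂) ,
          (done⇒reducible (receiving (unit-leaves σ λ _ _ ()) (name-leaves ∂ x)) ∷ [])
          ∷ (ih zero - N (approximable-child (-g (s≤s z≤n)) ap zero)
             ∷ done⇒reducible (receiving (node-leaves λ { zero → name-leaves ∂ N })
                 (name-leaves ∂ x)) ∷ [])
          ∷ []
      main - (ℊ (inj₂ ▷•)) (α ∷ []) ih x ap rewrite embed-subst (const (Φ α)) ρ =
        reduce-local λ Γ → let N , fr = fresh Γ in
          _ , approximate-ρ N (fr N ℕ.≤-refl 𝟏) ,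
          (done⇒reducible (receiving (unit-leaves ρ λ _ _ ()) (name-leaves ∂ x)) ∷ [])
          ∷ (ih zero + N (approximable-child (-g (s≤s z≤n)) ap zero)
             ∷ done⇒reducible (receiving (node-leaves λ { zero → name-leaves 𝟏 N })
                 (name-leaves ∂ x)) ∷ [])
          ∷ []
      main + (ℊ g) ts ih x (good , _) =
        display-PIA + (ℊ g) ts x (λ { (inj₁ ()) ; (inj₂ ()) }) good
      main - (𝒻 f) ts ih x (good , _) =
        display-PIA - (𝒻 f) ts x (λ { (inj₁ ()) ; (inj₂ ()) }) good

    -- Elimination of the variables

    Done-map : ∀ {R R′ C C′ : Fin n → Set} → (∀ {k} → R k → R′ k) → (∀ {k} → C k → C′ k) →
      ∀ {x} → Done R C x → Done R′ C′ x
    Done-map f g (critical c L)    = critical (g c) (Leaves-map (λ (r , lt) → f r , lt) L)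
    Done-map f g (receiving Ll Lr) = receiving (Leaves-map f Ll) (Leaves-map f Lr)

    [≔]-branch : ∀ p (u t : T) {τ τ′ k} → Branch τ (t [ p ≔ u ]) τ′ (prop k) →
      (k ≢ p × Branch τ t τ′ (prop k)) ⊎
      ∃ λ τ″ → Branch τ t τ″ (prop p) × Branch τ″ u τ′ (prop k)
    [≔]-branch p u t b with subst-branch t b
    ... | prop q , τ″ , b₁ , b₂ with q Fin.≟ p
    ...   | yes refl rewrite updateAt-updates q {const u} (λ k → atom (prop k)) =
            inj₂ (τ″ , b₁ , b₂)
    ...   | no q≢p rewrite updateAt-minimal q p {const u} (λ k → atom (prop k)) q≢p with b₂
    ...     | leaf = inj₁ (q≢p , b₁)

    -- A non-critical leaf `p` of `t` is signed `opposite (ε p)`, which is just the sign under which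
    -- the leaves of `u` are known to be non-critical.
    Leaves-[≔] : ∀ {τ} {t : T} {p} {u : T} {P Q P′ : Fin n → Set} →
      Leaves τ t P → Leaves (opposite (ε p)) u Q →
      (∀ {k} → k ≢ p → P k → P′ k) → (∀ {k} → P p → Q k → P′ k) → Leaves τ (t [ p ≔ u ]) P′
    Leaves-[≔] {t = t} {p} {u} Lt Lu f g τ′ k b with [≔]-branch p u t b
    ... | inj₁ (k≢p , b₁) = let eq , pk = Lt _ _ b₁ in eq , f k≢p pk
    ... | inj₂ (τ″ , b₁ , b₂) with Lt _ _ b₁
    ...   | refl , pp = let eq , qk = Lu _ _ b₂ in eq , g pp qk

    substItem-orient : ∀ p (u : T) st τ α β →
      substItem p u (st , orient τ α β) ≡ (st , orient τ (α [ p ≔ u ]) (β [ p ≔ u ]))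
    substItem-orient p u st 𝟏 α β = refl
    substItem-orient p u st ∂ α β = refl

    pivot : OrderType → Fin n → Status × T → Item n
    pivot ω p (st , α) = st , orient ω α (atom (prop p))

    Pivot : (R : Fin n → Set) → OrderType → Fin n → Status × T → Set
    Pivot R ω p (st , α) = st ≡ ordinary × Leaves (opposite ω) α (λ k → R k × k < p)

    partition : ∀ p {R C : Fin n → Set} {Γ} → All (Done R C) Γ → ∃₂ λ αs Θ →
      Γ ↭ List.map (pivot (ε p) p) αs ++ Θ ×
      All (Pivot R (ε p) p) αs × All (Done R (λ i → C i × i ≢ p)) Θ
    partition p [] = [] , [] , ↭-refl , [] , []
    partition p (d ∷ ds) with partition p ds | d
    ... | αs , Θ , perm , ps , rs | receiving Ll Lr =
          αs , _ ∷ Θ , ↭-trans (↭-prep _ perm) (↭-sym (shift _ _ Θ)) ,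
          ps , receiving Ll Lr ∷ rs
    ... | αs , Θ , perm , ps , rs | critical {i} c L with i Fin.≟ p
    ...   | yes refl = (ordinary , _) ∷ αs , Θ , ↭-prep _ perm , (refl , L) ∷ ps , rs
    ...   | no i≢p =
          αs , _ ∷ Θ , ↭-trans (↭-prep _ perm) (↭-sym (shift _ _ Θ)) ,
          ps , critical (c , i≢p) L ∷ rs

    -- By transitivity of _<_, the substitution only brings in variables below
    -- those it removes, so the variables may be eliminated in any order.
    done-[≔] : ∀ p u {R C : Fin n → Set} {x} → Leaves (opposite (ε p)) u (λ k → R k × k < p) →
      Done R (λ i → C i × i ≢ p) x →
      Done (λ k → R k × k ≢ p) (λ i → C i × i ≢ p) (substItem p u x)
    done-[≔] p u Lu (critical {i} {α} (c , i≢p) L)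
      rewrite substItem-orient p u ordinary (ε i) α (atom (prop i))
            | updateAt-minimal i p {const u} (λ k → atom (prop k)) i≢p =
      critical (c , i≢p) (Leaves-[≔] {t = α} L Lu
        (λ k≢p (r , k<i) → (r , k≢p) , k<i)
        (λ (_ , p<i) (r , k<p) → (r , λ eq → irrefl eq k<p) , <-trans k<p p<i))
    done-[≔] p u Lu (receiving {e = β ≤ γ} Ll Lr) = receiving (on β Ll) (on γ Lr)
      where
      on : ∀ t {τ} → Leaves τ t _ → Leaves τ (t [ p ≔ u ]) _
      on t L = Leaves-[≔] {t = t} L Lu (λ k≢p r → r , k≢p)
        (λ _ (r , k<p) → r , λ eq → irrefl eq k<p)

    ReceivesAt : Fin n → Inequality⁺⁺ n → Set
    ReceivesAt p e =
      (∀ τ → Branch - (lhs e) τ (prop p) → τ ≡ opposite (ε p)) ×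
      (∀ τ → Branch + (rhs e) τ (prop p) → τ ≡ opposite (ε p))

    receives-oriented : ∀ {p} τ {χ s} →
      (∀ τ′ → Branch (opposite τ) χ τ′ (prop p) → τ′ ≡ opposite (ε p)) →
      (∀ τ′ → Branch τ s τ′ (prop p) → τ′ ≡ opposite (ε p)) → ReceivesAt p (orient τ χ s)
    receives-oriented 𝟏 l r = l , r
    receives-oriented ∂ l r = r , l

    done⇒receives : ∀ {p} {R C : Fin n → Set} {st e} →
      Done R (λ i → C i × i ≢ p) (st , e) → ReceivesAt p e
    done⇒receives (critical {i} (_ , i≢p) L) = receives-oriented (ε i)
      (λ _ b → proj₁ (L _ _ b)) (λ { _ leaf → contradiction refl i≢p })
    done⇒receives (receiving Ll Lr) = (λ _ b → proj₁ (Ll _ _ b)) , (λ _ b → proj₁ (Lr _ _ b))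

    receives-lhs : ∀ {p e} → ReceivesAt p e → ∀ {τ} → Branch + (lhs e) τ (prop p) → τ ≡ ε p
    receives-lhs (l , _) b = Sign.opposite-injective (l _ (opposite-branch b))

    below-absent : ∀ {σ α p} {R : Fin n → Set} →
      Leaves σ α (λ k → R k × k < p) → ¬ Occurs (prop p) α
    below-absent {+}  L (_ , b) = irrefl refl (proj₂ (proj₂ (L _ _ b)))
    below-absent { - } L (_ , b) = irrefl refl (proj₂ (proj₂ (L _ _ (opposite-branch b))))

    ⋁-leaves : ∀ {P αs} → All (λ α → Leaves - α P) αs → Leaves - (⋁ αs) P
    ⋁-leaves (L ∷ [])               = L
    ⋁-leaves (L ∷ _ ∷ _)      τ′ k (through zero b)       = L τ′ k b
    ⋁-leaves (_ ∷ Ls@(_ ∷ _)) τ′ k (through (suc zero) b) = ⋁-leaves Ls τ′ k b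

    ⋀-leaves : ∀ {P αs} → All (λ α → Leaves + α P) αs → Leaves + (⋀ αs) P
    ⋀-leaves (L ∷ [])               = L
    ⋀-leaves (L ∷ _ ∷ _)      τ′ k (through zero b)       = L τ′ k b
    ⋀-leaves (_ ∷ Ls@(_ ∷ _)) τ′ k (through (suc zero) b) = ⋀-leaves Ls τ′ k b

    -- The order-type of `p` selects the Ackermann rule. If no inequality displays `p`, the list of
    -- pivots is empty and the rule substitutes `bot` or `top`.
    eliminate : ∀ p {R C : Fin n → Set} {Γ} → All (Done R C) Γ → ∃ λ Γ′ → Σ (Γ ⇒ Γ′ ∷ []) λ x →
      SafeStep x × All (Done (λ k → R k × k ≢ p) (λ i → C i × i ≢ p)) Γ′
    eliminate p {R} {C} {Γ} ds with partition p ds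
    ... | αs , Θ , perm , ps , rs = go (ε p) refl perm ps
      where
      substituted : ∀ u → Leaves (opposite (ε p)) u (λ k → R k × k < p) →
        All (Done (λ k → R k × k ≢ p) (λ i → C i × i ≢ p)) (List.map (substItem p u) Θ)
      substituted u Lu = All.map⁺ (All.map (done-[≔] p u Lu) rs)

      polarity : ∀ {x ω} → ε p ≡ ω → Done R (λ i → C i × i ≢ p) x →
        (∀ {τ} → Branch + (lhs (proj₂ x)) τ (prop p) → τ ≡ ω) ×
        (∀ {τ} → Branch + (rhs (proj₂ x)) τ (prop p) → τ ≡ opposite ω)
      polarity refl d = receives-lhs (done⇒receives d) , proj₂ (done⇒receives d) _

      -- `ε p` is generalised to `ω` so that the orientation of the pivots computes to the premise
      -- of the respective rule.
      go : ∀ ω → ε p ≡ ω → Γ ↭ List.map (pivot ω p) αs ++ Θ → All (Pivot R ω p) αs →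
        ∃ λ Γ′ → Σ (Γ ⇒ Γ′ ∷ []) λ x →
          SafeStep x × All (Done (λ k → R k × k ≢ p) (λ i → C i × i ≢ p)) Γ′
      go 𝟏 eq perm ps = _ ,
        ackermann p αs perm (All.map (below-absent ∘ proj₂) ps)
          (All.map (polarity eq) rs) ,
        All.map proj₁ ps ,
        substituted _ (≡.subst (λ ω → Leaves (opposite ω) _ _) (sym eq)
          (⋁-leaves (All.map⁺ (All.map proj₂ ps))))
      go ∂ eq perm ps = _ ,
        ackermann-dual p αs perm (All.map (below-absent ∘ proj₂) ps)
          (All.map (polarity eq) rs) ,
        All.map proj₁ ps ,
        substituted _ (≡.subst (λ ω → Leaves (opposite ω) _ _) (sym eq)
          (⋀-leaves (All.map⁺ (All.map proj₂ ps))))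

    done⇒pure : ∀ {Γ} → All (Done (_∈ []) (_∈ [])) Γ → Pure Γ
    done⇒pure = All.map pure
      where
      pure : ∀ {x} → Done (_∈ []) (_∈ []) x → ∀ p →
        ¬ Occurs (prop p) (lhs (proj₂ x)) × ¬ Occurs (prop p) (rhs (proj₂ x))
      pure (receiving Ll Lr) p =
        (λ (_ , b) → case proj₂ (Ll _ _ (opposite-branch b)) of λ ()) ,
        (λ (_ , b) → case proj₂ (Lr _ _ b) of λ ())

    solve : ∀ ps {Γ} → All (Done (_∈ ps) (_∈ ps)) Γ → Solvable Γ
    solve [] ds Γ′ perm = stop , tt , done⇒pure (All-resp-↭ (↭-sym perm) ds)
    solve (p ∷ ps) ds Γ′ perm with eliminate p (All-resp-↭ (↭-sym perm) ds)
    ... | _ , x , safe , ds′ = solve-step x safe (solve ps (All.map (Done-map tail tail) ds′) ∷ [])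
      where
      tail : ∀ {k} → k ∈ p ∷ ps × k ≢ p → k ∈ ps
      tail (here eq , k≢p)  = contradiction eq k≢p
      tail (there k∈ , _) = k∈

    solve-firstApproximation : ∀ {s t} → Exhausted (s ≤ t) → GoodTree + s → GoodTree - t →
      Solvable (firstApproximation (s ≤ t))
    solve-firstApproximation {s} {t} ex gs gt = reduce-all
      ( approximate s + 0 (gs , (λ _ d → ex (distribute-l d)) , λ { _ _ refl → ex split-∨ })
      ∷ approximate t - 0 (gt , (λ _ d → ex (distribute-r d)) , λ { _ _ refl → ex split-∧ })
      ∷ [])
      -- Initially every variable counts as remaining, so `U` becomes membership in the list of all
      -- variables.
      [] λ Δ ds → solve (List.allFin n)
        (All.++⁺ (All.map (Done-map (λ {k} _ → ∈-allFin k) (λ {k} _ → ∈-allFin k)) ds) [])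

theorem42 : (S : Signature) (π σ λᵗ ρ : DLE S 1) →
    Positive zero π → Positive zero σ → Negative zero λᵗ → Negative zero ρ →
    let open ALBAᵉ S π σ λᵗ ρ in
    (n : ℕ) (φ ψ : DLE S n) → MetaInductive φ ψ →
    Σ (Execution φ ψ) λ x → Safe x × Successful x
theorem42 S π σ λᵗ ρ π⁺ σ⁺ λ⁻ ρ⁻ n φ ψ
  (s , t , (ε , _<_ , irrefl , <-trans , ind-s , ind-t) , refl , refl) =
  let es , r , normal = preprocess (s ≤ t) (inductive⇒good ind-s , inductive⇒good ind-t)
      rs , safe , success = solve-all (All.map⁺ (All.map
        (λ (ex , gs , gt) → solve-firstApproximation ex gs gt) normal))
  in record { reads-φ = refl ; reads-ψ = refl ; preprocessed = r
            ; exhausted = All.map proj₁ normal ; runs = rs } , safe , success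
  where
  open Algorithm S π σ λᵗ ρ π⁺ σ⁺ λ⁻ ρ⁻
  open Ordered ε _<_ irrefl <-trans
  open SignedTrees.Goodness (S *ˢ) ε _<_
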